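{- For every integer $n\geq 1$, $$A_{n}(t)=\left(\frac{1+yt}{1+y}\right)^{n+1}P_{n}^{(\mathrm{pk},\mathrm{des})}\left(\frac{(1+y)^{2}t}{(y+t)(1+yt)},\frac{y+t}{1+yt}\right).$$ Equivalently, $$P_{n}^{(\mathrm{pk},\mathrm{des})}(y,t)=\left(\frac{1+u}{1+uv}\right)^{n+1}A_{n}(v),$$ where $$u=\frac{1+t^{2}-2yt-(1-t)\sqrt{(1+t)^{2}-4yt}}{2(1-y)t},\qquad v=\frac{(1+t)^{2}-2yt-(1+t)\sqrt{(1+t)^{2}-4yt}}{2yt}.$$
   Context: $\mathfrak{S}_n$ is the set of permutations $\pi=\pi_1\cdots\pi_n$ of $[n]=\{1,\dots,n\}$. For $\pi\in\mathfrak{S}_n$, $\mathrm{des}(\pi)$ is the number of descents, i.e. of $i\in[n-1]$ with $\pi_i>\pi_{i+1}$, and $\mathrm{pk}(\pi)$ is the number of peaks, i.e. of $i$ with $2\le i\le n-1$ and $\pi_{i-1}<\pi_i>\pi_{i+1}$. For $n\ge1$, the Eulerian polynomial is $A_n(t)=\sum_{\pi\in\mathfrak{S}_n}t^{\mathrm{des}(\pi)+1}$, and $P_n^{(\mathrm{pk},\mathrm{des})}(y,t)=\sum_{\pi\in\mathfrak{S}_n}y^{\mathrm{pk}(\pi)+1}t^{\mathrm{des}(\pi)+1}$. Here $y,t$ are indeterminates; the first identity is an identity of rational functions in $y,t$. In the second identity, $\sqrt{(1+t)^2-4yt}$ is the formal power series in $t$ over $\mathbb{Q}[y]$ with constant term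 $1$, so that $u$ and $v$ are formal power series in $t$ with coefficients in $\mathbb{Q}[y]$. -}

module Defs where

open import Algebra.Bundles using (CommutativeRing)
import Algebra.Properties.Ring as RingProperties
import Algebra.Properties.Semiring.Exp as Exp
import Algebra.Properties.Semiring.Sum as Sum
import Algebra.Solver.Ring.NaturalCoefficients.Default as Solver
open import Data.Bool.Base using (if_then_else_; _∧_)
open import Data.Fin.Base using (Fin; toℕ)
import Data.Fin.Properties as Fin
open import Data.List.Base
  using (List; []; _∷_; allFin; cartesianProductWith; filter; foldr; map)
import Data.List.Relation.Unary.Unique.DecPropositional as Unique
open import Data.Nat.Base as ℕ using (ℕ; zero; suc; _∸_; z≤n; s≤s)
import Data.Nat.Properties as ℕ
open import Data.Product.Base using (_×_; _,_)
open import Data.Rational.Base using (ℚ; 0ℚ; 1/_; ≢-nonZero)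
import Data.Rational.Properties as ℚ
open import Data.Sum.Base using (_⊎_; inj₁; inj₂)
open import Level using (Level; 0ℓ; _⊔_)
open import Relation.Binary.PropositionalEquality as ≡ using (_≡_)
import Relation.Binary.Reasoning.Setoid as SetoidReasoning
open import Relation.Nullary using (¬_; does; yes; no; contradiction)

private
  variable
    c ℓ : Level

------------------------------------------------------------------------
-- Permutations and their statistics

words : {A : Set} → List A → ℕ → List (List A)
words as zero    = [] ∷ []
words as (suc k) = cartesianProductWith _∷_ as (words as k)

-- The permutations of [n] in one-line notation π₁ ⋯ πₙ, each listed once:
-- the words of length n over an n-letter ordered alphabet without repeated
-- letters.  The letters are 0, …, n-1 rather than 1, …, n.
𝔖 : (n : ℕ) → List (List (Fin n))
𝔖 n = filter (Unique.unique? Fin._≟_) (words (allFin n) n)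

des : ∀ {m} → List (Fin m) → ℕ
des []                = 0
des (_ ∷ [])          = 0
des (a ∷ w@(b ∷ _))   = (if does (b Fin.<? a) then 1 else 0) ℕ.+ des w

-- Only interior positions 2 ≤ i ≤ n-1 can be peaks.
pk : ∀ {m} → List (Fin m) → ℕ
pk []                    = 0
pk (_ ∷ [])              = 0
pk (_ ∷ _ ∷ [])          = 0
pk (a ∷ w@(b ∷ d ∷ _))   =
  (if does (a Fin.<? b) ∧ does (d Fin.<? b) then 1 else 0) ℕ.+ pk w

-- The two polynomials have coefficients in ℕ, so they can be evaluated in
-- every commutative ring.  The polynomials themselves are the values at the
-- indeterminates.
module Polynomials (R : CommutativeRing c ℓ) where
  open CommutativeRing R
  open Exp semiring using (_^_)

  ∑[_] : {A : Set} → List A → (A → Carrier) → Carrier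
  ∑[ xs ] f = foldr _+_ 0# (map f xs)

  A : ℕ → Carrier → Carrier
  A n t = ∑[ 𝔖 n ] λ π → t ^ (des π ℕ.+ 1)

  Ppk,des : ℕ → Carrier → Carrier → Carrier
  Ppk,des n y t = ∑[ 𝔖 n ] λ π → (y ^ (pk π ℕ.+ 1)) * (t ^ (des π ℕ.+ 1))

------------------------------------------------------------------------
-- Formal power series R⟦X⟧

module PowerSeries (R : CommutativeRing c ℓ) where
  open CommutativeRing R
  open Sum semiring using (sum)
  open SetoidReasoning setoid
  open Solver commutativeSemiring using (solve; _:=_; _:+_; _:*_)

  Series : Set c
  Series = ℕ → Carrier

  infix 4 _≈ˢ_
  record _≈ˢ_ (f g : Series) : Set ℓ where
    constructor coeffwise
    field coeff-≈ : ∀ n → f n ≈ g n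
  open _≈ˢ_ public

  constant : Carrier → Series
  constant a zero    = a
  constant a (suc _) = 0#

  X : Series
  X zero          = 0#
  X (suc zero)    = 1#
  X (suc (suc _)) = 0#

  infixl 6 _+ˢ_
  infixl 7 _*ˢ_
  _+ˢ_ _*ˢ_ : Series → Series → Series
  (f +ˢ g) n = f n + g n
  (f *ˢ g) n = sum {suc n} λ i → f (toℕ i) * g (n ∸ toℕ i)

  -ˢ_ : Series → Series
  (-ˢ f) n = - f n

  0ˢ 1ˢ : Series
  0ˢ _ = 0#
  1ˢ   = constant 1#

  shift : Series → Series
  shift f n = f (suc n)

  *ˢ-cong : ∀ {f f′ g g′} → (∀ n → f n ≈ f′ n) → (∀ n → g n ≈ g′ n) →
            ∀ n → (f *ˢ g) n ≈ (f′ *ˢ g′) n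
  *ˢ-cong p q zero    = +-congʳ (*-cong (p 0) (q 0))
  *ˢ-cong p q (suc n) =
    +-cong (*-cong (p 0) (q (suc n))) (*ˢ-cong (λ k → p (suc k)) q n)

  *ˢ-zeroˡ : ∀ f g → (∀ n → f n ≈ 0#) → ∀ n → (f *ˢ g) n ≈ 0#
  *ˢ-zeroˡ f g p zero    = trans (+-identityʳ _) (trans (*-congʳ (p 0)) (zeroˡ _))
  *ˢ-zeroˡ f g p (suc n) = trans
    (+-cong (trans (*-congʳ (p 0)) (zeroˡ _)) (*ˢ-zeroˡ (shift f) g (λ k → p (suc k)) n))
    (+-identityʳ _)

  *ˢ-distribʳ : ∀ h f g n → ((f +ˢ g) *ˢ h) n ≈ (f *ˢ h) n + (g *ˢ h) n
  *ˢ-distribʳ h f g zero =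
    trans (+-identityʳ _) (trans (distribʳ _ _ _)
      (+-cong (sym (+-identityʳ _)) (sym (+-identityʳ _))))
  *ˢ-distribʳ h f g (suc n) = begin
    (f 0 + g 0) * h (suc n) + ((shift f +ˢ shift g) *ˢ h) n
      ≈⟨ +-cong (distribʳ _ _ _) (*ˢ-distribʳ h (shift f) (shift g) n) ⟩
    (f 0 * h (suc n) + g 0 * h (suc n)) + ((shift f *ˢ h) n + (shift g *ˢ h) n)
      ≈⟨ solve 4 (λ a b d e → (a :+ b) :+ (d :+ e) := (a :+ d) :+ (b :+ e)) refl _ _ _ _ ⟩
    (f 0 * h (suc n) + (shift f *ˢ h) n) + (g 0 * h (suc n) + (shift g *ˢ h) n) ∎

  *ˢ-scale : ∀ a f g n → ((λ k → a * f k) *ˢ g) n ≈ a * (f *ˢ g) n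
  *ˢ-scale a f g zero = begin
    a * f 0 * g 0 + 0#    ≈⟨ +-identityʳ _ ⟩
    a * f 0 * g 0         ≈⟨ *-assoc _ _ _ ⟩
    a * (f 0 * g 0)       ≈⟨ *-congˡ (+-identityʳ _) ⟨
    a * (f 0 * g 0 + 0#)  ∎
  *ˢ-scale a f g (suc n) =
    trans (+-cong (*-assoc _ _ _) (*ˢ-scale a (shift f) g n)) (sym (distribˡ _ _ _))

  *ˢ-assoc : ∀ f g h n → ((f *ˢ g) *ˢ h) n ≈ (f *ˢ (g *ˢ h)) n
  *ˢ-assoc f g h zero = begin
    (f 0 * g 0 + 0#) * h 0 + 0#    ≈⟨ +-congʳ (*-congʳ (+-identityʳ _)) ⟩
    f 0 * g 0 * h 0 + 0#           ≈⟨ +-congʳ (*-assoc _ _ _) ⟩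
    f 0 * (g 0 * h 0) + 0#         ≈⟨ +-congʳ (*-congˡ (+-identityʳ _)) ⟨
    f 0 * (g 0 * h 0 + 0#) + 0#    ∎
  *ˢ-assoc f g h (suc n) = begin
    (f 0 * g 0 + 0#) * h (suc n) + (((λ k → f 0 * shift g k) +ˢ (shift f *ˢ g)) *ˢ h) n
      ≈⟨ +-cong (*-congʳ (+-identityʳ _))
                (*ˢ-distribʳ h (λ k → f 0 * shift g k) (shift f *ˢ g) n) ⟩
    f 0 * g 0 * h (suc n) + (((λ k → f 0 * shift g k) *ˢ h) n + ((shift f *ˢ g) *ˢ h) n)
      ≈⟨ +-congˡ (+-cong (*ˢ-scale (f 0) (shift g) h n) (*ˢ-assoc (shift f) g h n)) ⟩
    f 0 * g 0 * h (suc n) + (f 0 * (shift g *ˢ h) n + (shift f *ˢ (g *ˢ h)) n)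
      ≈⟨ solve 5 (λ a b d e k → a :* b :* d :+ (a :* e :+ k) := a :* (b :* d :+ e) :+ k)
               refl _ _ _ _ _ ⟩
    f 0 * (g 0 * h (suc n) + (shift g *ˢ h) n) + (shift f *ˢ (g *ˢ h)) n ∎

  *ˢ-suc : ∀ f g n → (f *ˢ g) (suc n) ≈ f (suc n) * g 0 + (f *ˢ shift g) n
  *ˢ-suc f g zero = begin
    f 0 * g 1 + (f 1 * g 0 + 0#)  ≈⟨ +-congˡ (+-identityʳ _) ⟩
    f 0 * g 1 + f 1 * g 0         ≈⟨ +-comm _ _ ⟩
    f 1 * g 0 + f 0 * g 1         ≈⟨ +-congˡ (+-identityʳ _) ⟨
    f 1 * g 0 + (f 0 * g 1 + 0#)  ∎
  *ˢ-suc f g (suc n) = begin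
    f 0 * g (suc (suc n)) + (shift f *ˢ g) (suc n)
      ≈⟨ +-congˡ (*ˢ-suc (shift f) g n) ⟩
    f 0 * g (suc (suc n)) + (f (suc (suc n)) * g 0 + (shift f *ˢ shift g) n)
      ≈⟨ solve 3 (λ a b d → a :+ (b :+ d) := b :+ (a :+ d)) refl _ _ _ ⟩
    f (suc (suc n)) * g 0 + (f 0 * g (suc (suc n)) + (shift f *ˢ shift g) n) ∎

  *ˢ-comm : ∀ f g n → (f *ˢ g) n ≈ (g *ˢ f) n
  *ˢ-comm f g zero    = +-congʳ (*-comm _ _)
  *ˢ-comm f g (suc n) =
    trans (+-cong (*-comm _ _) (*ˢ-comm (shift f) g n)) (sym (*ˢ-suc g f n))

  *ˢ-identityˡ : ∀ f n → (1ˢ *ˢ f) n ≈ f n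
  *ˢ-identityˡ f zero    = trans (+-identityʳ _) (*-identityˡ _)
  *ˢ-identityˡ f (suc n) = trans
    (+-cong (*-identityˡ _) (*ˢ-zeroˡ (shift 1ˢ) f (λ _ → refl) n)) (+-identityʳ _)

  commutativeRing : CommutativeRing c ℓ
  commutativeRing = record
    { Carrier = Series ; _≈_ = _≈ˢ_ ; _+_ = _+ˢ_ ; _*_ = _*ˢ_ ; -_ = -ˢ_
    ; 0# = 0ˢ ; 1# = 1ˢ
    ; isCommutativeRing = record
      { isRing = record
        { +-isAbelianGroup = record
          { isGroup = record
            { isMonoid = record
              { isSemigroup = record
                { isMagma = record
                  { isEquivalence = record
                    { refl  = coeffwise λ _ → refl
                    ; sym   = λ p → coeffwise λ n → sym (coeff-≈ p n)
                    ; trans = λ p q → coeffwise λ n → trans (coeff-≈ p n) (coeff-≈ q n)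
                    }
                  ; ∙-cong = λ p q → coeffwise λ n → +-cong (coeff-≈ p n) (coeff-≈ q n)
                  }
                ; assoc = λ f g h → coeffwise λ n → +-assoc (f n) (g n) (h n)
                }
              ; identity = (λ f → coeffwise λ n → +-identityˡ (f n))
                         , (λ f → coeffwise λ n → +-identityʳ (f n))
              }
            ; inverse = (λ f → coeffwise λ n → -‿inverseˡ (f n))
                      , (λ f → coeffwise λ n → -‿inverseʳ (f n))
            ; ⁻¹-cong = λ p → coeffwise λ n → -‿cong (coeff-≈ p n)
            }
          ; comm = λ f g → coeffwise λ n → +-comm (f n) (g n)
          }
        ; *-cong = λ p q → coeffwise (*ˢ-cong (coeff-≈ p) (coeff-≈ q))
        ; *-assoc = λ f g h → coeffwise (*ˢ-assoc f g h)
        ; *-identity = (λ f → coeffwise (*ˢ-identityˡ f))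
                     , (λ f → coeffwise λ n → trans (*ˢ-comm f 1ˢ n) (*ˢ-identityˡ f n))
        ; distrib = (λ h f g → coeffwise λ n →
                       trans (*ˢ-comm h (f +ˢ g) n)
                       (trans (*ˢ-distribʳ h f g n)
                              (+-cong (*ˢ-comm f h n) (*ˢ-comm g h n))))
                  , (λ h f g → coeffwise (*ˢ-distribʳ h f g))
        }
      ; *-comm = λ f g → coeffwise (*ˢ-comm f g)
      }
    }

------------------------------------------------------------------------
-- Integral domains

record IsIntegralDomain (R : CommutativeRing c ℓ) : Set (c ⊔ ℓ) where
  open CommutativeRing R
  field
    1≉0            : ¬ (1# ≈ 0#)
    noZeroDivisors : ∀ x y → x * y ≈ 0# → x ≈ 0# ⊎ y ≈ 0#

  abstract
    *-≉0 : ∀ {x y} → ¬ (x ≈ 0#) → ¬ (y ≈ 0#) → ¬ (x * y ≈ 0#)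
    *-≉0 {x} {y} x≉0 y≉0 xy≈0 with noZeroDivisors x y xy≈0
    ... | inj₁ x≈0 = x≉0 x≈0
    ... | inj₂ y≈0 = y≉0 y≈0

  *-cancelˡ : ∀ z {x y} → ¬ (z ≈ 0#) → z * x ≈ z * y → x ≈ y
  *-cancelˡ z {x} {y} z≉0 zx≈zy with noZeroDivisors z (x + - y) z[x-y]≈0
    where
    open RingProperties ring using (x[y-z]≈xy-xz)
    z[x-y]≈0 : z * (x + - y) ≈ 0#
    z[x-y]≈0 = trans (x[y-z]≈xy-xz z x y)
                     (trans (+-congʳ zx≈zy) (-‿inverseʳ (z * y)))
  ... | inj₁ z≈0   = contradiction z≈0 z≉0
  ... | inj₂ x-y≈0 = RingProperties.x∙y⁻¹≈ε⇒x≈y ring x y x-y≈0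

------------------------------------------------------------------------
-- Polynomials R[X]: the power series with finitely many nonzero coefficients

module Polynomial (R : CommutativeRing c ℓ) where
  open CommutativeRing R
  private
    module S  = PowerSeries R
    module S′ = CommutativeRing S.commutativeRing
  open S using (Series; shift; _*ˢ_; _≈ˢ_; coeffwise; coeff-≈)
  open RingProperties ring using (-0#≈0#)

  VanishesFrom : ℕ → Series → Set ℓ
  VanishesFrom m f = ∀ n → m ℕ.≤ n → f n ≈ 0#

  record Poly : Set (c ⊔ ℓ) where
    no-eta-equality
    pattern
    constructor poly
    field
      coeff    : Series
      bound    : ℕ
      vanishes : VanishesFrom bound coeff
  open Poly public

  infix 4 _≈ᵖ_
  record _≈ᵖ_ (p q : Poly) : Set ℓ where
    constructor series
    field series-≈ : coeff p ≈ˢ coeff q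
  open _≈ᵖ_ public

  vanishes-* : ∀ m n f g → VanishesFrom m f → VanishesFrom n g →
               VanishesFrom (m ℕ.+ n) (f *ˢ g)
  vanishes-* zero    n f g p q k       _         =
    S.*ˢ-zeroˡ f g (λ i → p i z≤n) k
  vanishes-* (suc m) n f g p q (suc k) (s≤s m+n≤k) = trans
    (+-cong (trans (*-congˡ (q (suc k) n≤1+k)) (zeroʳ _))
            (vanishes-* m n (shift f) g (λ i m≤i → p (suc i) (s≤s m≤i)) q k m+n≤k))
    (+-identityʳ _)
    where
    n≤1+k : n ℕ.≤ suc k
    n≤1+k = ℕ.m≤n⇒m≤1+n (ℕ.≤-trans (ℕ.m≤n+m n m) m+n≤k)

  abstract
    constant-vanishes : ∀ a → VanishesFrom 1 (S.constant a)
    constant-vanishes a (suc _) _ = refl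

    X-vanishes : VanishesFrom 2 S.X
    X-vanishes (suc (suc _)) _        = refl
    X-vanishes (suc zero)    (s≤s ())

    +-vanishes : ∀ p q → VanishesFrom (bound p ℕ.+ bound q) (coeff p S.+ˢ coeff q)
    +-vanishes p q k m+n≤k = trans
      (+-cong (vanishes p k (ℕ.≤-trans (ℕ.m≤m+n (bound p) (bound q)) m+n≤k))
              (vanishes q k (ℕ.≤-trans (ℕ.m≤n+m (bound q) (bound p)) m+n≤k)))
      (+-identityʳ _)

    *-vanishes : ∀ p q → VanishesFrom (bound p ℕ.+ bound q) (coeff p *ˢ coeff q)
    *-vanishes p q =
      vanishes-* (bound p) (bound q) (coeff p) (coeff q) (vanishes p) (vanishes q)

    neg-vanishes : ∀ p → VanishesFrom (bound p) (S.-ˢ (coeff p))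
    neg-vanishes p k m≤k = trans (-‿cong (vanishes p k m≤k)) -0#≈0#

  constant : Carrier → Poly
  constant a = poly (S.constant a) 1 (constant-vanishes a)

  X : Poly
  X = poly S.X 2 X-vanishes

  infixl 6 _+ᵖ_
  infixl 7 _*ᵖ_
  _+ᵖ_ _*ᵖ_ : Poly → Poly → Poly
  p +ᵖ q = poly (coeff p S.+ˢ coeff q) (bound p ℕ.+ bound q) (+-vanishes p q)
  p *ᵖ q = poly (coeff p *ˢ coeff q) (bound p ℕ.+ bound q) (*-vanishes p q)

  -ᵖ_ : Poly → Poly
  -ᵖ p = poly (S.-ˢ (coeff p)) (bound p) (neg-vanishes p)

  0ᵖ 1ᵖ : Poly
  0ᵖ = poly S.0ˢ 0 λ _ _ → refl
  1ᵖ = constant 1#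

  commutativeRing : CommutativeRing (c ⊔ ℓ) ℓ
  commutativeRing = record
    { Carrier = Poly ; _≈_ = _≈ᵖ_ ; _+_ = _+ᵖ_ ; _*_ = _*ᵖ_ ; -_ = -ᵖ_
    ; 0# = 0ᵖ ; 1# = 1ᵖ
    ; isCommutativeRing = record
      { isRing = record
        { +-isAbelianGroup = record
          { isGroup = record
            { isMonoid = record
              { isSemigroup = record
                { isMagma = record
                  { isEquivalence = record
                    { refl  = series S′.refl
                    ; sym   = λ p → series (S′.sym (series-≈ p))
                    ; trans = λ p q → series (S′.trans (series-≈ p) (series-≈ q))
                    }
                  ; ∙-cong = λ p q → series (S′.+-cong (series-≈ p) (series-≈ q))
                  }
                ; assoc = λ f g h → series (S′.+-assoc (coeff f) (coeff g) (coeff h))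
                }
              ; identity = (λ f → series (S′.+-identityˡ (coeff f)))
                         , (λ f → series (S′.+-identityʳ (coeff f)))
              }
            ; inverse = (λ f → series (S′.-‿inverseˡ (coeff f)))
                      , (λ f → series (S′.-‿inverseʳ (coeff f)))
            ; ⁻¹-cong = λ p → series (S′.-‿cong (series-≈ p))
            }
          ; comm = λ f g → series (S′.+-comm (coeff f) (coeff g))
          }
        ; *-cong = λ p q → series (S′.*-cong (series-≈ p) (series-≈ q))
        ; *-assoc = λ f g h → series (S′.*-assoc (coeff f) (coeff g) (coeff h))
        ; *-identity = (λ f → series (S′.*-identityˡ (coeff f)))
                     , (λ f → series (S′.*-identityʳ (coeff f)))
        ; distrib = (λ h f g → series (S′.distribˡ (coeff h) (coeff f) (coeff g)))
                  , (λ h f g → series (S′.distribʳ (coeff h) (coeff f) (coeff g)))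
        }
      ; *-comm = λ f g → series (S′.*-comm (coeff f) (coeff g))
      }
    }

  module _ (D : IsIntegralDomain R) where
    open IsIntegralDomain D

    zero-or-zero : ∀ m n f g → VanishesFrom m f → VanishesFrom n g →
                   (∀ k → (f *ˢ g) k ≈ 0#) → (∀ k → f k ≈ 0#) ⊎ (∀ k → g k ≈ 0#)
    zero-or-zero zero    n       f g p q _ = inj₁ λ k → p k z≤n
    zero-or-zero (suc m) zero    f g p q _ = inj₂ λ k → q k z≤n
    zero-or-zero (suc m) (suc n) f g p q fg≈0
      with noZeroDivisors (f 0) (g 0) (trans (sym (+-identityʳ _)) (fg≈0 0))
    ... | inj₁ f₀≈0
        with zero-or-zero m (suc n) (shift f) g (λ k m≤k → p (suc k) (s≤s m≤k)) q
               (λ k → trans (sym (trans (+-congʳ (trans (*-congʳ f₀≈0) (zeroˡ _)))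
                                        (+-identityˡ _)))
                            (fg≈0 (suc k)))
    ...   | inj₁ f≈0 = inj₁ λ { zero → f₀≈0 ; (suc k) → f≈0 k }
    ...   | inj₂ g≈0 = inj₂ g≈0
    zero-or-zero (suc m) (suc n) f g p q fg≈0
        | inj₂ g₀≈0
        with zero-or-zero (suc m) n f (shift g) p (λ k n≤k → q (suc k) (s≤s n≤k))
               (λ k → trans (sym (trans (+-congʳ (trans (*-congˡ g₀≈0) (zeroʳ _)))
                                        (+-identityˡ _)))
                            (trans (sym (S.*ˢ-suc f g k)) (fg≈0 (suc k))))
    ...   | inj₁ f≈0 = inj₁ f≈0
    ...   | inj₂ g≈0 = inj₂ λ { zero → g₀≈0 ; (suc k) → g≈0 k }

    isIntegralDomain : IsIntegralDomain commutativeRing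
    isIntegralDomain = record
      { 1≉0 = λ 1≈0 → 1≉0 (coeff-≈ (series-≈ 1≈0) 0)
      ; noZeroDivisors = nzd
      }
      where
      nzd : ∀ p q → p *ᵖ q ≈ᵖ 0ᵖ → p ≈ᵖ 0ᵖ ⊎ q ≈ᵖ 0ᵖ
      nzd (poly f m p) (poly g n q) pq≈0
        with zero-or-zero m n f g p q (coeff-≈ (series-≈ pq≈0))
      ... | inj₁ f≈0 = inj₁ (series (coeffwise f≈0))
      ... | inj₂ g≈0 = inj₂ (series (coeffwise g≈0))

module Bivariate (R : CommutativeRing c ℓ) (D : IsIntegralDomain R) where
  private
    module R    = CommutativeRing R
    module R[y] = CommutativeRing (Polynomial.commutativeRing R)
    module S    = PowerSeries R
    module S[y] = PowerSeries (Polynomial.commutativeRing R)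
    module P    = Polynomial R
    module P[y] = Polynomial (Polynomial.commutativeRing R)
  open CommutativeRing P[y].commutativeRing public using (Carrier; _≈_; _+_; _*_; 0#; 1#)
  open IsIntegralDomain D using (1≉0)

  y t : Carrier
  y = P[y].constant P.X
  t = P[y].X

  private
    coefficient : ∀ i j p → p ≈ 0# → P.coeff (P[y].coeff p j) i R.≈ R.0#
    coefficient i j p p≈0 = S.coeff-≈ (P.series-≈ (S[y].coeff-≈ (P[y].series-≈ p≈0) j)) i

  1+y≉0 : ¬ (1# + y ≈ 0#)
  1+y≉0 eq = 1≉0 (R.trans (R.sym (R.+-identityʳ R.1#)) (coefficient 0 0 (1# + y) eq))

  1+yt≉0 : ¬ (1# + y * t ≈ 0#)
  1+yt≉0 eq = 1≉0 (R.trans (R.sym collapse) (coefficient 0 0 (1# + y * t) eq))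
    where
    collapse : R.1# R.+ ((R.0# R.* R.0# R.+ R.0#) R.+ R.0#) R.≈ R.1#
    collapse = R.trans
      (R.+-congˡ (R.trans (R.+-identityʳ _) (R.trans (R.+-identityʳ _) (R.zeroʳ R.0#))))
      (R.+-identityʳ R.1#)

  y+t≉0 : ¬ (y + t ≈ 0#)
  y+t≉0 eq = 1≉0 (R.trans (R.sym (R.+-identityʳ R.1#)) (coefficient 1 0 (y + t) eq))

------------------------------------------------------------------------
-- The field of fractions of an integral domain

module FractionField (R : CommutativeRing c ℓ) (D : IsIntegralDomain R) where
  open CommutativeRing R
  open IsIntegralDomain D
  open RingProperties ring using (-‿distribˡ-*)
  open Solver commutativeSemiring using (solve; _:=_; _:+_; _:*_; con)
  open SetoidReasoning setoid

  record Fraction : Set (c ⊔ ℓ) where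
    no-eta-equality
    pattern
    constructor fraction
    field
      num   : Carrier
      den   : Carrier
      den≉0 : ¬ (den ≈ 0#)
  open Fraction public

  infix 4 _≈ᶠ_
  record _≈ᶠ_ (x y : Fraction) : Set ℓ where
    constructor cross
    field cross-≈ : num x * den y ≈ num y * den x
  open _≈ᶠ_ public

  ι : Carrier → Fraction
  ι a = fraction a 1# 1≉0

  infixl 6 _+ᶠ_
  infixl 7 _*ᶠ_
  _+ᶠ_ _*ᶠ_ : Fraction → Fraction → Fraction
  x +ᶠ y = fraction (num x * den y + num y * den x) (den x * den y) (*-≉0 (den≉0 x) (den≉0 y))
  x *ᶠ y = fraction (num x * num y) (den x * den y) (*-≉0 (den≉0 x) (den≉0 y))

  -ᶠ_ : Fraction → Fraction
  -ᶠ x = fraction (- num x) (den x) (den≉0 x)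

  0ᶠ 1ᶠ : Fraction
  0ᶠ = ι 0#
  1ᶠ = ι 1#

  num≉0 : ∀ x → ¬ (x ≈ᶠ 0ᶠ) → ¬ (num x ≈ 0#)
  num≉0 x x≉0 a≈0 =
    x≉0 (cross (trans (trans (*-congʳ a≈0) (zeroˡ 1#)) (sym (zeroˡ (den x)))))

  infixl 7 _/_[_]
  _/_[_] : (x y : Fraction) → ¬ (y ≈ᶠ 0ᶠ) → Fraction
  x / y [ y≉0 ] = x *ᶠ fraction (den y) (num y) (num≉0 y y≉0)

  /-*-cancel : ∀ x y y≉0 → (x / y [ y≉0 ]) *ᶠ y ≈ᶠ x
  /-*-cancel (fraction a s _) (fraction b t _) _ = cross
    (solve 4 (λ a s b t → a :* t :* b :* s := a :* (s :* b :* t)) refl a s b t)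

  ≈ᶠ-trans : ∀ {x y z} → x ≈ᶠ y → y ≈ᶠ z → x ≈ᶠ z
  ≈ᶠ-trans {fraction a s _} {fraction b t t≉0} {fraction d r _} (cross p) (cross q) =
    cross (*-cancelˡ t t≉0 (begin
      t * (a * r)  ≈⟨ solve 3 (λ t a r → t :* (a :* r) := a :* t :* r) refl t a r ⟩
      a * t * r    ≈⟨ *-congʳ p ⟩
      b * s * r    ≈⟨ solve 3 (λ b s r → b :* s :* r := b :* r :* s) refl b s r ⟩
      b * r * s    ≈⟨ *-congʳ q ⟩
      d * t * s    ≈⟨ solve 3 (λ d t s → d :* t :* s := t :* (d :* s)) refl d t s ⟩
      t * (d * s)  ∎))

  +ᶠ-cong : ∀ {x x′ y y′} → x ≈ᶠ x′ → y ≈ᶠ y′ → x +ᶠ y ≈ᶠ x′ +ᶠ y′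
  +ᶠ-cong {fraction a s _} {fraction a′ s′ _} {fraction b t _} {fraction b′ t′ _}
          (cross p) (cross q) = cross (begin
    (a * t + b * s) * (s′ * t′)
      ≈⟨ solve 6 (λ a t b s s′ t′ → (a :* t :+ b :* s) :* (s′ :* t′)
           := a :* s′ :* (t :* t′) :+ b :* t′ :* (s :* s′)) refl a t b s s′ t′ ⟩
    a * s′ * (t * t′) + b * t′ * (s * s′)
      ≈⟨ +-cong (*-congʳ p) (*-congʳ q) ⟩
    a′ * s * (t * t′) + b′ * t * (s * s′)
      ≈⟨ solve 6 (λ a′ t b′ s s′ t′ → a′ :* s :* (t :* t′) :+ b′ :* t :* (s :* s′)
           := (a′ :* t′ :+ b′ :* s′) :* (s :* t)) refl a′ t b′ s s′ t′ ⟩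
    (a′ * t′ + b′ * s′) * (s * t) ∎)

  *ᶠ-cong : ∀ {x x′ y y′} → x ≈ᶠ x′ → y ≈ᶠ y′ → x *ᶠ y ≈ᶠ x′ *ᶠ y′
  *ᶠ-cong {fraction a s _} {fraction a′ s′ _} {fraction b t _} {fraction b′ t′ _}
          (cross p) (cross q) = cross (begin
    a * b * (s′ * t′)    ≈⟨ swap a b s′ t′ ⟩
    a * s′ * (b * t′)    ≈⟨ *-cong p q ⟩
    a′ * s * (b′ * t)    ≈⟨ swap a′ s b′ t ⟩
    a′ * b′ * (s * t)    ∎)
    where
    swap : ∀ i j k l → i * j * (k * l) ≈ i * k * (j * l)
    swap = solve 4 (λ i j k l → i :* j :* (k :* l) := i :* k :* (j :* l)) refl

  -ᶠ-cong : ∀ {x x′} → x ≈ᶠ x′ → -ᶠ x ≈ᶠ -ᶠ x′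
  -ᶠ-cong {fraction a s _} {fraction a′ s′ _} (cross p) = cross
    (trans (sym (-‿distribˡ-* a s′)) (trans (-‿cong p) (-‿distribˡ-* a′ s)))

  +ᶠ-assoc : ∀ x y z → (x +ᶠ y) +ᶠ z ≈ᶠ x +ᶠ (y +ᶠ z)
  +ᶠ-assoc (fraction a s _) (fraction b t _) (fraction d r _) = cross
    (solve 6 (λ a s b t d r →
      ((a :* t :+ b :* s) :* r :+ d :* (s :* t)) :* (s :* (t :* r))
      := (a :* (t :* r) :+ (b :* r :+ d :* t) :* s) :* (s :* t :* r)) refl a s b t d r)

  +ᶠ-comm : ∀ x y → x +ᶠ y ≈ᶠ y +ᶠ x
  +ᶠ-comm (fraction a s _) (fraction b t _) = cross
    (solve 4 (λ a s b t → (a :* t :+ b :* s) :* (t :* s)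
                       := (b :* s :+ a :* t) :* (s :* t)) refl a s b t)

  +ᶠ-identityˡ : ∀ x → 0ᶠ +ᶠ x ≈ᶠ x
  +ᶠ-identityˡ (fraction a s _) = cross
    (solve 2 (λ a s → (con 0 :* s :+ a :* con 1) :* s := a :* (con 1 :* s)) refl a s)

  -ᶠ-inverseˡ : ∀ x → (-ᶠ x) +ᶠ x ≈ᶠ 0ᶠ
  -ᶠ-inverseˡ (fraction a s _) = cross (begin
    (- a * s + a * s) * 1#     ≈⟨ *-identityʳ _ ⟩
    - a * s + a * s            ≈⟨ distribʳ s (- a) a ⟨
    (- a + a) * s              ≈⟨ *-congʳ (-‿inverseˡ a) ⟩
    0# * s                     ≈⟨ zeroˡ s ⟩
    0#                         ≈⟨ zeroˡ (s * s) ⟨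
    0# * (s * s)               ∎)

  *ᶠ-comm : ∀ x y → x *ᶠ y ≈ᶠ y *ᶠ x
  *ᶠ-comm (fraction a s _) (fraction b t _) = cross
    (solve 4 (λ a s b t → a :* b :* (t :* s) := b :* a :* (s :* t)) refl a s b t)

  *ᶠ-assoc : ∀ x y z → (x *ᶠ y) *ᶠ z ≈ᶠ x *ᶠ (y *ᶠ z)
  *ᶠ-assoc (fraction a s _) (fraction b t _) (fraction d r _) = cross
    (solve 6 (λ a s b t d r → a :* b :* d :* (s :* (t :* r))
                           := a :* (b :* d) :* (s :* t :* r)) refl a s b t d r)

  *ᶠ-identityˡ : ∀ x → 1ᶠ *ᶠ x ≈ᶠ x
  *ᶠ-identityˡ (fraction a s _) = cross
    (solve 2 (λ a s → con 1 :* a :* s := a :* (con 1 :* s)) refl a s)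

  *ᶠ-distribˡ : ∀ x y z → x *ᶠ (y +ᶠ z) ≈ᶠ x *ᶠ y +ᶠ x *ᶠ z
  *ᶠ-distribˡ (fraction a s _) (fraction b t _) (fraction d r _) = cross
    (solve 6 (λ a s b t d r →
      a :* (b :* r :+ d :* t) :* (s :* t :* (s :* r))
      := (a :* b :* (s :* r) :+ a :* d :* (s :* t)) :* (s :* (t :* r))) refl a s b t d r)

  *ᶠ-distribʳ : ∀ x y z → (y +ᶠ z) *ᶠ x ≈ᶠ y *ᶠ x +ᶠ z *ᶠ x
  *ᶠ-distribʳ x y z = ≈ᶠ-trans (*ᶠ-comm (y +ᶠ z) x)
    (≈ᶠ-trans (*ᶠ-distribˡ x y z) (+ᶠ-cong (*ᶠ-comm x y) (*ᶠ-comm x z)))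

  ι-+ : ∀ a b → ι (a + b) ≈ᶠ ι a +ᶠ ι b
  ι-+ a b = cross (solve 2 (λ a b → (a :+ b) :* (con 1 :* con 1)
                                 := (a :* con 1 :+ b :* con 1) :* con 1) refl a b)

  ι-* : ∀ a b → ι (a * b) ≈ᶠ ι a *ᶠ ι b
  ι-* a b = cross (solve 2 (λ a b → (a :* b) :* (con 1 :* con 1)
                                 := (a :* b) :* con 1) refl a b)

  ι-≈0 : ∀ {a} → ι a ≈ᶠ 0ᶠ → a ≈ 0#
  ι-≈0 (cross p) = trans (sym (*-identityʳ _)) (trans p (zeroˡ 1#))

  commutativeRing : CommutativeRing (c ⊔ ℓ) ℓ
  commutativeRing = record
    { Carrier = Fraction ; _≈_ = _≈ᶠ_ ; _+_ = _+ᶠ_ ; _*_ = _*ᶠ_ ; -_ = -ᶠ_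
    ; 0# = 0ᶠ ; 1# = 1ᶠ
    ; isCommutativeRing = record
      { isRing = record
        { +-isAbelianGroup = record
          { isGroup = record
            { isMonoid = record
              { isSemigroup = record
                { isMagma = record
                  { isEquivalence = record
                    { refl  = cross refl
                    ; sym   = λ p → cross (sym (cross-≈ p))
                    ; trans = ≈ᶠ-trans
                    }
                  ; ∙-cong = +ᶠ-cong
                  }
                ; assoc = +ᶠ-assoc
                }
              ; identity = +ᶠ-identityˡ
                         , λ x → ≈ᶠ-trans (+ᶠ-comm x 0ᶠ) (+ᶠ-identityˡ x)
              }
            ; inverse = -ᶠ-inverseˡ
                      , λ x → ≈ᶠ-trans (+ᶠ-comm x (-ᶠ x)) (-ᶠ-inverseˡ x)
            ; ⁻¹-cong = -ᶠ-cong
            }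
          ; comm = +ᶠ-comm
          }
        ; *-cong = *ᶠ-cong
        ; *-assoc = *ᶠ-assoc
        ; *-identity = *ᶠ-identityˡ
                     , λ x → ≈ᶠ-trans (*ᶠ-comm x 1ᶠ) (*ᶠ-identityˡ x)
        ; distrib = *ᶠ-distribˡ , *ᶠ-distribʳ
        }
      ; *-comm = *ᶠ-comm
      }
    }

  isIntegralDomain : IsIntegralDomain commutativeRing
  isIntegralDomain = record
    { 1≉0 = λ { (cross p) → 1≉0 (trans (sym (*-identityʳ 1#)) (trans p (zeroˡ 1#))) }
    ; noZeroDivisors = nzd
    }
    where
    nzd : ∀ x y → x *ᶠ y ≈ᶠ 0ᶠ → x ≈ᶠ 0ᶠ ⊎ y ≈ᶠ 0ᶠ
    nzd (fraction a s _) (fraction b t _) (cross p)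
      with noZeroDivisors a b (trans (sym (*-identityʳ _)) (trans p (zeroˡ _)))
    ... | inj₁ a≈0 = inj₁ (cross (trans (*-congʳ a≈0) (trans (zeroˡ _) (sym (zeroˡ _)))))
    ... | inj₂ b≈0 = inj₂ (cross (trans (*-congʳ b≈0) (trans (zeroˡ _) (sym (zeroˡ _)))))

-- The field of fractions of R[y,t] = R[y][t]
module RationalFunctionField (R : CommutativeRing c ℓ) (D : IsIntegralDomain R) where
  private
    R[y,t] = Polynomial.commutativeRing (Polynomial.commutativeRing R)

    R[y,t]-isIntegralDomain : IsIntegralDomain R[y,t]
    R[y,t]-isIntegralDomain =
      Polynomial.isIntegralDomain (Polynomial.commutativeRing R) (Polynomial.isIntegralDomain R D)

    module B = Bivariate R D
    module F = FractionField R[y,t] R[y,t]-isIntegralDomain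

  open CommutativeRing F.commutativeRing public
    using (Carrier; _≈_; _+_; _*_; 0#; 1#; semiring)
  open CommutativeRing F.commutativeRing using (trans; +-congˡ)
  open Exp semiring public using (_^_)
  open F public using (_/_[_])
  open Polynomials F.commutativeRing public using (A; Ppk,des)

  y t : Carrier
  y = F.ι B.y
  t = F.ι B.t

  1+y≉0 : ¬ (1# + y ≈ 0#)
  1+y≉0 eq = B.1+y≉0 (F.ι-≈0 (trans (F.ι-+ B.1# B.y) eq))

  1+yt≉0 : ¬ (1# + y * t ≈ 0#)
  1+yt≉0 eq = B.1+yt≉0 (F.ι-≈0
    (trans (F.ι-+ B.1# (B.y B.* B.t)) (trans (+-congˡ {1#} (F.ι-* B.y B.t)) eq)))

  y+t≉0 : ¬ (y + t ≈ 0#)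
  y+t≉0 eq = B.y+t≉0 (F.ι-≈0 (trans (F.ι-+ B.y B.t) eq))

  [y+t][1+yt]≉0 : ¬ ((y + t) * (1# + y * t) ≈ 0#)
  [y+t][1+yt]≉0 = IsIntegralDomain.*-≉0 F.isIntegralDomain {y + t} {1# + y * t} y+t≉0 1+yt≉0

-- The power series ring R[y]⟦t⟧
module PowerSeriesInT (R : CommutativeRing c ℓ) where
  private
    module P = Polynomial R
    module S = PowerSeries P.commutativeRing

  open CommutativeRing S.commutativeRing public
    using (Carrier; _≈_; _+_; _*_; _-_; 0#; 1#; semiring)
  open Exp semiring public using (_^_)
  open Polynomials S.commutativeRing public using (A; Ppk,des)

  y t 2# 4# : Carrier
  y  = S.constant P.X
  t  = S.X
  2# = 1# + 1#
  4# = 2# + 2#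

  -- q = a / b.  If R is an integral domain then so is R[y]⟦t⟧, and at most
  -- one q qualifies.
  _IsQuotient_/_ : Carrier → Carrier → Carrier → Set ℓ
  q IsQuotient a / b = ¬ (b ≈ 0#) × (q * b ≈ a)

  -- s = √f, normalised to have constant term 1 in R[y].
  _IsSqrtOf_ : Carrier → Carrier → Set ℓ
  s IsSqrtOf f = (s 0 P.≈ᵖ P.1ᵖ) × (s ^ 2 ≈ f)

  -- s is the square root in the formulas for u and v, and r = (1 + u) / (1 + uv).
  -- For R = ℚ the equations determine s, u, v and r uniquely.
  record Substitution : Set (c ⊔ ℓ) where
    field
      s u v r : Carrier
      s-sqrt  : s IsSqrtOf ((1# + t) ^ 2 - 4# * y * t)
      u-def   : u IsQuotient (1# + t ^ 2 - 2# * y * t - (1# - t) * s) / (2# * (1# - y) * t)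
      v-def   : v IsQuotient ((1# + t) ^ 2 - 2# * y * t - (1# + t) * s) / (2# * y * t)
      r-def   : r IsQuotient (1# + u) / (1# + u * v)

------------------------------------------------------------------------
-- The coefficient field ℚ

ℚ-ring : CommutativeRing 0ℓ 0ℓ
ℚ-ring = ℚ.+-*-commutativeRing

ℚ-isIntegralDomain : IsIntegralDomain ℚ-ring
ℚ-isIntegralDomain = record { 1≉0 = λ () ; noZeroDivisors = nzd }
  where
  open CommutativeRing ℚ-ring
  nzd : ∀ p q → p * q ≡ 0ℚ → p ≡ 0ℚ ⊎ q ≡ 0ℚ
  nzd p q pq≡0 with p ℚ.≟ 0ℚ
  ... | yes p≡0 = inj₁ p≡0
  ... | no  p≢0 = inj₂ (≡.trans (≡.sym (ℚ.*-identityˡ q))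
                       (≡.trans (≡.cong (_* q) (≡.sym (ℚ.*-inverseˡ p)))
                       (≡.trans (ℚ.*-assoc (1/ p) p q)
                       (≡.trans (≡.cong ((1/ p) *_) pq≡0) (ℚ.*-zeroʳ (1/ p))))))
    where instance _ = ≢-nonZero p≢0

-- Give a nonempty word w the weight r^(|w|+1) Y^(pk w+1) T^(des w+1).  If x exceeds every letter
-- of u and v, the weight of u x v is the product of the weights of u and v when both are nonempty;
-- an empty u (resp. v) contributes the factor r T (resp. r) instead, and x alone weighs r² Y T.
-- Removing the maximum and symmetrising over the two sides, the total weight r^(n+1) Pₙ(Y,T) of
-- the permutations of [n] is seen to depend only on r + r T and r² Y T.  Since Aₙ(t) = Pₙ(1,t),
-- it remains to check that the substitutions in the theorem preserve these two quantities:
-- in the first identity r + r T = 1 + t and r² Y T = t, in the second r + r v = 1 + t and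
-- r² v = y t.  For the latter, with s the square root, 2 r = 1 + t + s.

module Submission where

open import Defs
open import Algebra.Bundles using (CommutativeRing)
import Algebra.Properties.AbelianGroup as AbelianGroupProperties
import Algebra.Properties.CommutativeSemiring.Exp as Exp
import Algebra.Properties.Ring as RingProperties
import Algebra.Properties.Semiring.Mult.TCOptimised as Mult
import Algebra.Solver.Ring as RingSolver
open import Algebra.Solver.Ring.AlmostCommutativeRing
  using (_-Raw-AlmostCommutative⟶_; fromCommutativeRing)
import Algebra.Solver.Ring.NaturalCoefficients.Default as NatSolver
open import Data.Bool.Base using (Bool; if_then_else_; _∧_; true; false)
open import Data.Bool.Properties using (∧-zeroʳ)
open import Data.Fin.Base as Fin using (Fin; opposite)
import Data.Fin.Properties as Fin
open import Data.Integer.Base as ℤ using (ℤ; -[1+_]; _⊖_; _◃_) renaming (+_ to pos)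
import Data.Integer.Properties as ℤ
open import Data.List.Base
  using (List; []; _∷_; [_]; _++_; allFin; concatMap; foldr; length; map; tabulate)
import Data.List.Properties as List
open import Data.List.Membership.Propositional using (_∈_; find; lose)
open import Data.List.Membership.Propositional.Properties
open import Data.List.Membership.Propositional.Properties.WithK using (unique∧set⇒bag)
open import Data.List.Relation.Binary.BagAndSetEquality using (∼bag⇒↭)
open import Data.List.Relation.Binary.Disjoint.Propositional using (Disjoint)
open import Data.List.Relation.Binary.Permutation.Propositional
  using (_↭_; ↭-refl; ↭-sym; ↭-trans; ↭-prep; ↭-reflexive; ↭⇒↭ₛ)
import Data.List.Relation.Binary.Permutation.Propositional.Properties as Perm
import Data.List.Relation.Binary.Permutation.Setoid.Properties as PermSetoid
open import Data.List.Relation.Binary.Sublist.Heterogeneous.Properties using (length-mono-≤)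
open import Data.List.Relation.Binary.Sublist.Propositional using (_⊆_; []; _∷_; _∷ʳ_)
open import Data.List.Relation.Binary.Sublist.Propositional.Properties using (All-resp-⊆)
open import Data.List.Relation.Unary.All as All using (All; []; _∷_)
import Data.List.Relation.Unary.All.Properties as All
open import Data.List.Relation.Unary.AllPairs as AllPairs using (AllPairs; []; _∷_)
import Data.List.Relation.Unary.AllPairs.Properties as AllPairs
open import Data.List.Relation.Unary.Any using (here; there)
import Data.List.Relation.Unary.Unique.DecPropositional as DecUnique
open import Data.List.Relation.Unary.Unique.Propositional using (Unique)
import Data.List.Relation.Unary.Unique.Propositional.Properties as Unique
open import Data.Maybe.Base using (Maybe; just; nothing)
open import Data.Nat as ℕ using (ℕ; zero; suc; _≥_; z≤n; s≤s)
import Data.Nat.Properties as ℕ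
open import Data.Product using (_×_; _,_; ∃; map₁; map₂; proj₁; proj₂)
import Data.Sign.Base as Sign
open import Data.Sum.Base using (inj₁; inj₂)
open import Function.Base using (_∘_; _$_)
open import Function.Bundles using (mk⇔)
open import Level using (Level)
open import Relation.Binary.PropositionalEquality as ≡ using (_≡_; _≢_)
import Relation.Binary.Reasoning.Setoid as SetoidReasoning
open import Relation.Nullary using (¬_; contradiction; does; no; yes)
open import Relation.Nullary.Decidable using (dec-false; dec-true)

-- The two sides of the maximum carry arbitrary sets of letters. The induction therefore runs over
-- decreasing lists of letters instead of over `n`, and no word has to be renumbered. The obstacle
-- is the empty word: its weight r Y T is not determined by the two quantities, and neither is a
-- one-sided factor r or r T, only their sum. Hence the recursion stays on nonempty lists, and
-- mirror splits are grouped by the side on which one fixed letter lies, which needs no division by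
-- two. In the second identity r and r v are the two roots of z² - (1 + t) z + y t, and s is their
-- difference. The root w = r v is divisible by t, and w / t solves a fixed-point equation over the
-- coefficient ring, so the square root and the quotients exist as power series without any
-- extraction of roots or inversion.

private
  variable
    c ℓ : Level
    E E′ : Set

-- A ring solver with integer coefficients

module IntegerCoefficients (R : CommutativeRing c ℓ) where
  open CommutativeRing R
  open Mult semiring using (×-homo-+; ×1-homo-*; 1+×) renaming (_×_ to _×′_)
  open RingProperties ring using (-‿distribˡ-*; -‿distribʳ-*; -‿involutive; -0#≈0#)
  open AbelianGroupProperties +-abelianGroup using (⁻¹-∙-comm)
  open SetoidReasoning setoid

  private
    open NatSolver commutativeSemiring using (solve; _:=_; _:+_)

    ⟦_⟧ : ℤ → Carrier
    ⟦ pos n ⟧    = n ×′ 1#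
    ⟦ -[1+ n ] ⟧ = - (suc n ×′ 1#)

    ⊖-homo : ∀ m n → ⟦ m ⊖ n ⟧ ≈ m ×′ 1# - n ×′ 1#
    ⊖-homo m       zero    = sym (trans (+-congˡ -0#≈0#) (+-identityʳ _))
    ⊖-homo zero    (suc n) = sym (+-identityˡ _)
    ⊖-homo (suc m) (suc n) = begin
      ⟦ suc m ⊖ suc n ⟧
        ≡⟨ ≡.cong ⟦_⟧ (ℤ.[1+m]⊖[1+n]≡m⊖n m n) ⟩
      ⟦ m ⊖ n ⟧
        ≈⟨ ⊖-homo m n ⟩
      m ×′ 1# - n ×′ 1#
        ≈⟨ trans (+-congʳ (-‿inverseʳ 1#)) (+-identityˡ _) ⟨
      (1# - 1#) + (m ×′ 1# - n ×′ 1#)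
        ≈⟨ solve 4 (λ a b d e → (a :+ b) :+ (d :+ e) := (a :+ d) :+ (b :+ e)) refl _ _ _ _ ⟩
      (1# + m ×′ 1#) + (- 1# + - (n ×′ 1#))
        ≈⟨ +-congˡ (⁻¹-∙-comm _ _) ⟩
      (1# + m ×′ 1#) - (1# + n ×′ 1#)
        ≈⟨ +-cong (1+× m 1#) (-‿cong (1+× n 1#)) ⟨
      suc m ×′ 1# - suc n ×′ 1# ∎

    -◃-homo : ∀ n → ⟦ Sign.- ◃ n ⟧ ≈ - (n ×′ 1#)
    -◃-homo zero    = sym -0#≈0#
    -◃-homo (suc n) = refl

    +-homo : ∀ i j → ⟦ i ℤ.+ j ⟧ ≈ ⟦ i ⟧ + ⟦ j ⟧
    +-homo (pos m)  (pos n)  = ×-homo-+ 1# m n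
    +-homo (pos m)  -[1+ n ] = ⊖-homo m (suc n)
    +-homo -[1+ m ] (pos n)  = trans (⊖-homo n (suc m)) (+-comm _ _)
    +-homo -[1+ m ] -[1+ n ] = begin
      - (suc (suc (m ℕ.+ n)) ×′ 1#)  ≡⟨ ≡.cong (λ k → - (suc k ×′ 1#)) (ℕ.+-suc m n) ⟨
      - ((suc m ℕ.+ suc n) ×′ 1#)    ≈⟨ -‿cong (×-homo-+ 1# (suc m) (suc n)) ⟩
      - (suc m ×′ 1# + suc n ×′ 1#)  ≈⟨ ⁻¹-∙-comm _ _ ⟨
      - (suc m ×′ 1#) - suc n ×′ 1#  ∎

    *-homo : ∀ i j → ⟦ i ℤ.* j ⟧ ≈ ⟦ i ⟧ * ⟦ j ⟧
    *-homo (pos m)  (pos n)  = trans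
      (reflexive (≡.cong ⟦_⟧ (ℤ.+◃n≡+n (m ℕ.* n)))) (×1-homo-* m n)
    *-homo (pos m)  -[1+ n ] = trans (-◃-homo (m ℕ.* suc n))
      (trans (-‿cong (×1-homo-* m (suc n))) (-‿distribʳ-* _ _))
    *-homo -[1+ m ] (pos n)  = trans (-◃-homo (suc m ℕ.* n))
      (trans (-‿cong (×1-homo-* (suc m) n)) (-‿distribˡ-* _ _))
    *-homo -[1+ m ] -[1+ n ] = begin
      (suc m ℕ.* suc n) ×′ 1#            ≈⟨ ×1-homo-* (suc m) (suc n) ⟩
      suc m ×′ 1# * suc n ×′ 1#          ≈⟨ -‿involutive _ ⟨
      - - (suc m ×′ 1# * suc n ×′ 1#)    ≈⟨ -‿cong (-‿distribʳ-* _ _) ⟩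
      - (suc m ×′ 1# * - (suc n ×′ 1#))  ≈⟨ -‿distribˡ-* _ _ ⟩
      - (suc m ×′ 1#) * - (suc n ×′ 1#)  ∎

    neg-homo : ∀ i → ⟦ ℤ.- i ⟧ ≈ - ⟦ i ⟧
    neg-homo (pos zero)    = sym -0#≈0#
    neg-homo (pos (suc n)) = refl
    neg-homo -[1+ n ]      = sym (-‿involutive _)

    homomorphism : ℤ.+-*-rawRing -Raw-AlmostCommutative⟶ fromCommutativeRing R
    homomorphism = record
      { ⟦_⟧    = ⟦_⟧
      ; +-homo = +-homo
      ; *-homo = *-homo
      ; -‿homo = neg-homo
      ; 0-homo = refl
      ; 1-homo = refl
      }

    equal? : ∀ i j → Maybe (⟦ i ⟧ ≈ ⟦ j ⟧)
    equal? i j with i ℤ.≟ j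
    ... | yes i≡j = just (reflexive (≡.cong ⟦_⟧ i≡j))
    ... | no  _   = nothing

  open RingSolver ℤ.+-*-rawRing (fromCommutativeRing R) homomorphism equal? public

-- Regular elements and quotients

module Regularity (R : CommutativeRing c ℓ) where
  open CommutativeRing R
  open Exp commutativeSemiring using (_^_)
  open RingProperties ring using (x∙y⁻¹≈ε⇒x≈y)
  open IntegerCoefficients R

  -- Cancellability of one element, used instead of `IsIntegralDomain`: for power series, deciding
  -- which factor of a vanishing product is zero is out of reach constructively, while the
  -- particular denominators can be cancelled.
  Regular : Carrier → Set _
  Regular a = ∀ {x} → a * x ≈ 0# → x ≈ 0#

  regular-* : ∀ {a b} → Regular a → Regular b → Regular (a * b)
  regular-* ra rb eq = rb (ra (trans (sym (*-assoc _ _ _)) eq))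

  regular⇒≉0 : ¬ (1# ≈ 0#) → ∀ {a} → Regular a → ¬ (a ≈ 0#)
  regular⇒≉0 1≉0 ra a≈0 = 1≉0 (ra (trans (*-congʳ a≈0) (zeroˡ 1#)))

  domain-regular : IsIntegralDomain R → ∀ {a} → ¬ (a ≈ 0#) → Regular a
  domain-regular D a≉0 {x} eq with IsIntegralDomain.noZeroDivisors D _ x eq
  ... | inj₁ a≈0 = contradiction a≈0 a≉0
  ... | inj₂ x≈0 = x≈0

  regular-cancel : ∀ {a} → Regular a → ∀ {x y} → a * (x - y) ≈ 0# → x ≈ y
  regular-cancel ra eq = x∙y⁻¹≈ε⇒x≈y _ _ (ra eq)

  difference≈0 : ∀ {x y} → x ≈ y → x - y ≈ 0#
  difference≈0 {x} {y} eq = trans (+-congʳ eq) (-‿inverseʳ y)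

  -- Chains of these turn a certificate x - y = Σ aᵢ (xᵢ - yᵢ) into a derivation of x ≈ y
  -- from the equations xᵢ ≈ yᵢ.
  infixr 6 _∙_⊕_
  _∙_⊕_ : ∀ a {x y z} → x ≈ y → z ≈ 0# → a * (x - y) + z ≈ 0#
  a ∙ eq ⊕ z≈0 =
    trans (+-cong (trans (*-congˡ (difference≈0 eq)) (zeroʳ a)) z≈0) (+-identityʳ 0#)

  record IsQuotient (a b q : Carrier) : Set ℓ where
    constructor quotient
    field
      b≉0   : ¬ (b ≈ 0#)
      q*b≈a : q * b ≈ a

  module _ {a b d t r T : Carrier} (a-regular : Regular a)
           (r-eq : r * a ≈ b) (T-eq : T * b ≈ d) where

    -- In fractions r = b/a and T = d/b, so r + r T = (b + d)/a. In the first identity a = 1 + y, b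
    -- = 1 + y t and d = y + t, and the hypothesis is `factorisation`.
    r+rT≈1+t : b + d ≈ a * (1# + t) → r + r * T ≈ 1# + t
    r+rT≈1+t b+d-eq = regular-cancel a-regular (trans
      (solve 6 (λ a b d t r T →
        a :* (r :+ r :* T :- (con (pos 1) :+ t)) :=
        (con (pos 1) :+ T) :* (r :* a :- b) :+
        (con (pos 1) :* (T :* b :- d) :+
        (con (pos 1) :* (b :+ d :- a :* (con (pos 1) :+ t)) :+ con (pos 0))))
        refl a b d t r T)
      ((1# + T) ∙ r-eq ⊕ 1# ∙ T-eq ⊕ 1# ∙ b+d-eq ⊕ refl))

    -- In fractions r² Y T = (b/a)² (c/e) (d/b), which collapses to c/a² because e = d b.
    rrYT≈t : ∀ {c e Y} → Y * e ≈ c → c ≈ a ^ 2 * t → e ≈ d * b → r * r * (Y * T) ≈ t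
    rrYT≈t {c} {e} {Y} Y-eq c-eq e-eq =
      regular-cancel (regular-* a-regular a-regular) (trans
        (solve 9 (λ a b c d e t r Y T →
          a :* a :* (r :* r :* (Y :* T) :- t) :=
          (r :* a :+ b) :* Y :* T :* (r :* a :- b) :+
          (b :* Y :* (T :* b :- d) :+
          (con (pos 1) :* (Y :* e :- c) :+
          (:- Y :* (e :- d :* b) :+
          (con (pos 1) :* (c :- a :^ 2 :* t) :+ con (pos 0))))))
          refl a b c d e t r Y T)
        ((r * a + b) * Y * T ∙ r-eq ⊕ b * Y ∙ T-eq ⊕ 1# ∙ Y-eq ⊕ - Y ∙ e-eq ⊕ 1# ∙ c-eq ⊕ refl))

  factorisation : ∀ y t → (1# + y * t) + (y + t) ≈ (1# + y) * (1# + t)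
  factorisation = solve 2 (λ y t → (con (pos 1) :+ y :* t) :+ (y :+ t) :=
                                   (con (pos 1) :+ y) :* (con (pos 1) :+ t)) refl

-- Arrangements of a list

cuts : {A : Set} → List A → List (List A × List A)
cuts []      = [ [] , [] ]
cuts (y ∷ w) = ([] , y ∷ w) ∷ map (map₁ (y ∷_)) (cuts w)

-- Both halves keep the order of the list, so the halves of a decreasing list are decreasing and
-- again fall under the induction.
splits : {A : Set} → List A → List (List A × List A)
splits []      = [ [] , [] ]
splits (y ∷ S) = map (map₁ (y ∷_)) (splits S) ++ map (map₂ (y ∷_)) (splits S)

insertions : {A : Set} → A → List A → List (List A)
insertions x w = map (λ (u , v) → u ++ x ∷ v) (cuts w)

-- The head is inserted last. For a decreasing list it is the maximum, so this recursion exhibits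
-- each word as u x v with x maximal.
arrangements : {A : Set} → List A → List (List A)
arrangements []      = [ [] ]
arrangements (x ∷ S) = concatMap (insertions x) (arrangements S)

module _ {A : Set} where

  cuts-++ : (w : List A) → All (λ (u , v) → u ++ v ≡ w) (cuts w)
  cuts-++ []      = ≡.refl ∷ []
  cuts-++ (y ∷ w) = ≡.refl ∷ All.map⁺ (All.map (≡.cong (y ∷_)) (cuts-++ w))

  ∈-cuts : (u v : List A) → (u , v) ∈ cuts (u ++ v)
  ∈-cuts []      []      = here ≡.refl
  ∈-cuts []      (_ ∷ _) = here ≡.refl
  ∈-cuts (y ∷ u) v       = there (∈-map⁺ (map₁ (y ∷_)) (∈-cuts u v))

  cuts-unique : (w : List A) → Unique (cuts w)
  cuts-unique []      = [] ∷ []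
  cuts-unique (y ∷ w) =
    All.map⁺ (All.universal (λ _ ()) (cuts w))
    ∷ Unique.map⁺ (λ { ≡.refl → ≡.refl }) (cuts-unique w)

  ∈-arrangements⁻ : ∀ S {w : List A} → w ∈ arrangements S → w ↭ S
  ∈-arrangements⁻ []      (here ≡.refl) = ↭-refl
  ∈-arrangements⁻ (x ∷ S) w∈
    with w′ , w′∈ , w∈ins ← find (∈-concatMap⁻ (insertions x) w∈)
    with (u , v) , uv∈ , ≡.refl ← ∈-map⁻ _ w∈ins
    = ↭-trans (Perm.shift x u v)
        (↭-prep x (↭-trans (↭-reflexive (All.lookup (cuts-++ w′) uv∈))
                           (∈-arrangements⁻ S w′∈)))

  ∈-arrangements⁺ : ∀ S {w : List A} → w ↭ S → w ∈ arrangements S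
  ∈-arrangements⁺ [] w↭[] = here (Perm.↭-empty-inv w↭[])
  ∈-arrangements⁺ (x ∷ S) w↭x∷S
    with u , v , ≡.refl ← ∈-∃++ (Perm.∈-resp-↭ (↭-sym w↭x∷S) (here ≡.refl))
    = ∈-concatMap⁺ (insertions x)
        (lose (∈-arrangements⁺ S (Perm.drop-mid u [] w↭x∷S)) (∈-map⁺ _ (∈-cuts u v)))

  -- Both prefixes end just before the first occurrence of `x`, so they are the same prefix.
  insert-injective : ∀ {x : A} u u′ {v v′} → All (x ≢_) u → All (x ≢_) u′ →
                     u ++ x ∷ v ≡ u′ ++ x ∷ v′ → (u , v) ≡ (u′ , v′)
  insert-injective []      []       _          _          ≡.refl = ≡.refl
  insert-injective []      (_ ∷ _)  _          (x≢x ∷ _)  ≡.refl = contradiction ≡.refl x≢x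
  insert-injective (_ ∷ _) []       (x≢x ∷ _)  _          ≡.refl = contradiction ≡.refl x≢x
  insert-injective (y ∷ u) (_ ∷ u′) (_ ∷ x∉u)  (_ ∷ x∉u′) eq
    with ≡.refl , eq′ ← List.∷-injective eq
    = ≡.cong (map₁ (y ∷_)) (insert-injective u u′ x∉u x∉u′ eq′)

  AllPairs-map-All : {B : Set} {P : B → Set} {R S : B → B → Set} →
                     (∀ {a b} → P a → P b → R a b → S a b) →
                     ∀ {xs} → All P xs → AllPairs R xs → AllPairs S xs
  AllPairs-map-All f []         []         = []
  AllPairs-map-All f (px ∷ pxs) (rx ∷ rxs) =
    All.zipWith (λ (py , rxy) → f px py rxy) (pxs , rx) ∷ AllPairs-map-All f pxs rxs

  All-cuts : {P : A → Set} (w : List A) → All P w → All (All P ∘ proj₁) (cuts w)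
  All-cuts {P} w pw =
    All.map (λ {(u , v)} eq → All.++⁻ˡ u (≡.subst (All P) (≡.sym eq) pw)) (cuts-++ w)

  -- Since `x` does not occur in `S`, a word determines the place where `x` was inserted and, after
  -- deleting `x`, the arrangement into which it was inserted.
  arrangements-unique : (S : List A) → Unique S → Unique (arrangements S)
  arrangements-unique []      []          = [] ∷ []
  arrangements-unique (x ∷ S) (x∉S ∷ S!) =
    Unique.concat⁺ (All.map⁺ (All.map insertions! x∉arrangements))
      (AllPairs.map⁺ (AllPairs-map-All disjoint x∉arrangements (arrangements-unique S S!)))
    where
    x∉arrangements : All (All (x ≢_)) (arrangements S)
    x∉arrangements =
      All.tabulate λ w∈ → Perm.All-resp-↭ (↭-sym (∈-arrangements⁻ S w∈)) x∉S

    insertions! : ∀ {w} → All (x ≢_) w → Unique (insertions x w)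
    insertions! {w} x∉w = AllPairs.map⁺ (AllPairs-map-All
      (λ {(u , _)} {(u′ , _)} x∉u x∉u′ ≢ eq → ≢ (insert-injective u u′ x∉u x∉u′ eq))
      (All-cuts w x∉w) (cuts-unique w))

    disjoint : ∀ {w w′} → All (x ≢_) w → All (x ≢_) w′ → w ≢ w′ →
               Disjoint (insertions x w) (insertions x w′)
    disjoint {w} {w′} x∉w x∉w′ w≢w′ (z∈ , z∈′)
      with (u , v) , uv∈ , ≡.refl ← ∈-map⁻ _ z∈
      with (u′ , v′) , uv∈′ , eq ← ∈-map⁻ _ z∈′
      with ≡.refl ← insert-injective u u′ (All.lookup (All-cuts w x∉w) uv∈)
                                          (All.lookup (All-cuts w′ x∉w′) uv∈′) eq
      = w≢w′ (≡.trans (≡.sym (All.lookup (cuts-++ w) uv∈)) (All.lookup (cuts-++ w′) uv∈′))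

  -- Pigeonhole.
  unique-⊆⇒↭ : ∀ {w S : List A} → Unique w → All (_∈ S) w → length w ≡ length S → w ↭ S
  unique-⊆⇒↭ {[]}    {[]}     _          _           _   = ↭-refl
  unique-⊆⇒↭ {[]}    {_ ∷ _}  _          _           ()
  unique-⊆⇒↭ {x ∷ w}          (x∉w ∷ w!) (x∈S ∷ w⊆S) |w|≡|S|
    with us , vs , ≡.refl ← ∈-∃++ x∈S
    = ↭-trans (↭-prep x (unique-⊆⇒↭ w! (All.zipWith drop (x∉w , w⊆S)) |w|≡|us++vs|))
              (↭-sym (Perm.shift x us vs))
    where
    drop : ∀ {y} → x ≢ y × y ∈ us ++ x ∷ vs → y ∈ us ++ vs
    drop (x≢y , y∈) with Perm.∈-resp-↭ (Perm.shift x us vs) y∈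
    ... | here y≡x  = contradiction (≡.sym y≡x) x≢y
    ... | there y∈′ = y∈′

    |w|≡|us++vs| : length w ≡ length (us ++ vs)
    |w|≡|us++vs| =
      ℕ.suc-injective (≡.trans |w|≡|S| (Perm.↭-length (Perm.shift x us vs)))

  ∈-words⁺ : ∀ {as : List A} {w} → All (_∈ as) w → w ∈ words as (length w)
  ∈-words⁺ []         = here ≡.refl
  ∈-words⁺ (a∈ ∷ w∈) = ∈-cartesianProductWith⁺ _∷_ a∈ (∈-words⁺ w∈)

  ∈-words⁻ : ∀ (as : List A) k {w} → w ∈ words as k → length w ≡ k
  ∈-words⁻ as zero    (here ≡.refl) = ≡.refl
  ∈-words⁻ as (suc k) w∈
    with _ , _ , _ , w′∈ , ≡.refl ← ∈-cartesianProductWith⁻ _∷_ as (words as k) w∈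
    = ≡.cong suc (∈-words⁻ as k w′∈)

  words-unique : ∀ {as : List A} → Unique as → ∀ k → Unique (words as k)
  words-unique as! zero    = [] ∷ []
  words-unique as! (suc k) =
    Unique.cartesianProductWith⁺ _∷_ List.∷-injective as! (words-unique as! k)

-- Reversed order of the letters, so that the maximum comes first, where `arrangements` expects it.
descending : ∀ n → List (Fin n)
descending n = tabulate opposite

descending-decreasing : ∀ n → AllPairs Fin._>_ (descending n)
descending-decreasing n = AllPairs.tabulate⁺-< λ {i} {j} i<j →
  ≡.subst₂ ℕ._<_ (≡.sym (Fin.opposite-prop j)) (≡.sym (Fin.opposite-prop i))
    (ℕ.∸-monoʳ-< (ℕ.s≤s i<j) (Fin.toℕ<n j))

-- Neither list has repetitions and they have the same members, so they agree as bags.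
𝔖↭arrangements : ∀ n → 𝔖 n ↭ arrangements (descending n)
𝔖↭arrangements n = ∼bag⇒↭ $ unique∧set⇒bag
  (Unique.filter⁺ unique? (words-unique (Unique.allFin⁺ n) n))
  (arrangements-unique S S!)
  (mk⇔ to from)
  where
  S = descending n
  unique? = DecUnique.unique? Fin._≟_

  S! : Unique S
  S! = AllPairs.map (λ i>j i≡j → Fin.<⇒≢ i>j (≡.sym i≡j)) (descending-decreasing n)

  |S|≡n : length S ≡ n
  |S|≡n = List.length-tabulate opposite

  ∈S : ∀ k → k ∈ S
  ∈S k = ≡.subst (_∈ S) (Fin.opposite-involutive k) (∈-tabulate⁺ (opposite k))

  to : ∀ {w} → w ∈ 𝔖 n → w ∈ arrangements S
  to w∈ with w∈words , w! ← ∈-filter⁻ unique? {xs = words (allFin n) n} w∈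
    = ∈-arrangements⁺ S (unique-⊆⇒↭ w! (All.universal ∈S _)
        (≡.trans (∈-words⁻ (allFin n) n w∈words) (≡.sym |S|≡n)))

  from : ∀ {w} → w ∈ arrangements S → w ∈ 𝔖 n
  from {w} w∈ = ∈-filter⁺ unique?
    (≡.subst (λ k → w ∈ words (allFin n) k) (≡.trans (Perm.↭-length w↭S) |S|≡n)
             (∈-words⁺ (All.universal ∈-allFin w)))
    (PermSetoid.Unique-resp-↭ (≡.setoid _) (↭⇒↭ₛ (↭-sym w↭S)) S!)
    where w↭S = ∈-arrangements⁻ S w∈

-- Descents and peaks around the maximum

ind : Bool → ℕ
ind b = if b then 1 else 0

module _ {m} (x : Fin m) where

  private
    <x : ∀ {a : Fin m} → a Fin.< x → does (a Fin.<? x) ≡ true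
    <x {a} = dec-true (a Fin.<? x)

    x≮ : ∀ {a : Fin m} → a Fin.< x → does (x Fin.<? a) ≡ false
    x≮ {a} a<x = dec-false (x Fin.<? a) (ℕ.<⇒≯ a<x)

  des-max-∷ : ∀ b v → All (Fin._< x) (b ∷ v) → des (x ∷ b ∷ v) ≡ suc (des (b ∷ v))
  des-max-∷ b v (b< ∷ _) = ≡.cong (λ p → ind p ℕ.+ des (b ∷ v)) (<x {b} b<)

  des-insert-max : ∀ a u b v → All (Fin._< x) (a ∷ u) → All (Fin._< x) (b ∷ v) →
                   des (a ∷ u ++ x ∷ b ∷ v) ≡ des (a ∷ u) ℕ.+ suc (des (b ∷ v))
  des-insert-max a []      b v (a< ∷ _)  v< =
    ≡.cong₂ (λ p k → ind p ℕ.+ k) (x≮ {a} a<) (des-max-∷ b v v<)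
  des-insert-max a (c ∷ u) b v (_ ∷ u<) v< =
    ≡.trans (≡.cong (_ ℕ.+_) (des-insert-max c u b v u< v<))
      (≡.sym (ℕ.+-assoc (ind (does (c Fin.<? a))) (des (c ∷ u)) _))

  des-∷ʳ-max : ∀ a u → All (Fin._< x) (a ∷ u) → des (a ∷ u ++ [ x ]) ≡ des (a ∷ u)
  des-∷ʳ-max a []      (a< ∷ _) = ≡.cong (λ p → ind p ℕ.+ 0) (x≮ {a} a<)
  des-∷ʳ-max a (c ∷ u) (_ ∷ u<) = ≡.cong (_ ℕ.+_) (des-∷ʳ-max c u u<)

  pk-max-∷ : ∀ b v → All (Fin._< x) (b ∷ v) → pk (x ∷ b ∷ v) ≡ pk (b ∷ v)
  pk-max-∷ b []      _        = ≡.refl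
  pk-max-∷ b (c ∷ v) (b< ∷ _) =
    ≡.cong (λ p → ind (p ∧ does (c Fin.<? b)) ℕ.+ pk (b ∷ c ∷ v)) (x≮ {b} b<)

  private
    -- The last letter of a word is not a peak by position; once `x` follows it, it is not a peak
    -- because `x` is larger.
    last-no-peak : ∀ (a c : Fin m) → c Fin.< x → ind (does (a Fin.<? c) ∧ does (x Fin.<? c)) ≡ 0
    last-no-peak a c c< = ≡.cong ind
      (≡.trans (≡.cong (does (a Fin.<? c) ∧_) (x≮ {c} c<)) (∧-zeroʳ (does (a Fin.<? c))))

  -- The maximum is a new peak. Its neighbours were ends of their words, hence no peaks, and beside
  -- the maximum they still are none.
  pk-insert-max : ∀ a u b v → All (Fin._< x) (a ∷ u) → All (Fin._< x) (b ∷ v) →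
                  pk (a ∷ u ++ x ∷ b ∷ v) ≡ pk (a ∷ u) ℕ.+ suc (pk (b ∷ v))
  pk-insert-max a []          b v (a< ∷ _) v<@(b< ∷ _) = ≡.cong₂ ℕ._+_
    (≡.cong₂ (λ p q → ind (p ∧ q)) (<x {a} a<) (<x {b} b<)) (pk-max-∷ b v v<)
  pk-insert-max a (c ∷ [])    b v (_ ∷ u<@(c< ∷ _)) v< =
    ≡.cong₂ ℕ._+_ (last-no-peak a c c<) (pk-insert-max c [] b v u< v<)
  pk-insert-max a (c ∷ d ∷ u) b v (_ ∷ u<) v< = ≡.trans
    (≡.cong (_ ℕ.+_) (pk-insert-max c (d ∷ u) b v u< v<))
    (≡.sym (ℕ.+-assoc (ind (does (a Fin.<? c) ∧ does (d Fin.<? c))) (pk (c ∷ d ∷ u)) _))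

  pk-∷ʳ-max : ∀ a u → All (Fin._< x) (a ∷ u) → pk (a ∷ u ++ [ x ]) ≡ pk (a ∷ u)
  pk-∷ʳ-max a []          _            = ≡.refl
  pk-∷ʳ-max a (c ∷ [])    (_ ∷ c< ∷ _) = ≡.cong (ℕ._+ 0) (last-no-peak a c c<)
  pk-∷ʳ-max a (c ∷ d ∷ u) (_ ∷ u<)     = ≡.cong (_ ℕ.+_) (pk-∷ʳ-max c (d ∷ u) u<)

-- Finite sums

module _ {A : Set} where

  AllPairs-resp-⊆ : {Q : A → A → Set} → ∀ {xs ys} → xs ⊆ ys → AllPairs Q ys → AllPairs Q xs
  AllPairs-resp-⊆ []             []         = []
  AllPairs-resp-⊆ (_ ∷ʳ σ)       (_ ∷ qs)   = AllPairs-resp-⊆ σ qs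
  AllPairs-resp-⊆ (≡.refl ∷ σ)   (q ∷ qs)   = All-resp-⊆ σ q ∷ AllPairs-resp-⊆ σ qs

  splits-⊆ : (S : List A) → All (λ (L , M) → L ⊆ S × M ⊆ S) (splits S)
  splits-⊆ []      = ([] , []) ∷ []
  splits-⊆ (y ∷ S) = All.++⁺
    (All.map⁺ (All.map (λ (σ , τ) → (≡.refl ∷ σ) , (y ∷ʳ τ)) (splits-⊆ S)))
    (All.map⁺ (All.map (λ (σ , τ) → (y ∷ʳ σ) , (≡.refl ∷ τ)) (splits-⊆ S)))

module Summation (R : CommutativeRing c ℓ) where
  open CommutativeRing R
  open Polynomials R using (∑[_])
  open NatSolver commutativeSemiring using (solve; _:=_; _:+_)
  open SetoidReasoning setoid

  ∑-cong-All : ∀ {xs : List E} {f g} → All (λ x → f x ≈ g x) xs → ∑[ xs ] f ≈ ∑[ xs ] g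
  ∑-cong-All []         = refl
  ∑-cong-All (eq ∷ eqs) = +-cong eq (∑-cong-All eqs)

  ∑-cong : ∀ (xs : List E) {f g} → (∀ x → f x ≈ g x) → ∑[ xs ] f ≈ ∑[ xs ] g
  ∑-cong xs eq = ∑-cong-All (All.universal eq xs)

  ∑-++ : ∀ (xs ys : List E) f → ∑[ xs ++ ys ] f ≈ ∑[ xs ] f + ∑[ ys ] f
  ∑-++ []       ys f = sym (+-identityˡ _)
  ∑-++ (x ∷ xs) ys f = trans (+-congˡ (∑-++ xs ys f)) (sym (+-assoc _ _ _))

  ∑-0 : ∀ (xs : List E) → ∑[ xs ] (λ _ → 0#) ≈ 0#
  ∑-0 []       = refl
  ∑-0 (_ ∷ xs) = trans (+-identityˡ _) (∑-0 xs)

  ∑-+ : ∀ (xs : List E) f g → ∑[ xs ] (λ x → f x + g x) ≈ ∑[ xs ] f + ∑[ xs ] g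
  ∑-+ []       f g = sym (+-identityˡ 0#)
  ∑-+ (x ∷ xs) f g = trans (+-congˡ (∑-+ xs f g))
    (solve 4 (λ a b d e → (a :+ b) :+ (d :+ e) := (a :+ d) :+ (b :+ e)) refl _ _ _ _)

  ∑-*ˡ : ∀ (xs : List E) a f → ∑[ xs ] (λ x → a * f x) ≈ a * ∑[ xs ] f
  ∑-*ˡ []       a f = sym (zeroʳ a)
  ∑-*ˡ (x ∷ xs) a f = trans (+-congˡ (∑-*ˡ xs a f)) (sym (distribˡ _ _ _))

  ∑-*ʳ : ∀ (xs : List E) a f → ∑[ xs ] (λ x → f x * a) ≈ ∑[ xs ] f * a
  ∑-*ʳ xs a f = trans (∑-cong xs λ x → *-comm (f x) a) (trans (∑-*ˡ xs a f) (*-comm _ _))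

  ∑-map : ∀ (h : E → E′) xs f → ∑[ map h xs ] f ≡ ∑[ xs ] (f ∘ h)
  ∑-map h xs f = ≡.cong (foldr _+_ 0#) (≡.sym (List.map-∘ xs))

  ∑-concatMap : ∀ (h : E → List E′) xs f → ∑[ concatMap h xs ] f ≈ ∑[ xs ] (λ x → ∑[ h x ] f)
  ∑-concatMap h []       f = refl
  ∑-concatMap h (x ∷ xs) f =
    trans (∑-++ (h x) (concatMap h xs) f) (+-congˡ (∑-concatMap h xs f))

  ∑-comm : ∀ (xs : List E) (ys : List E′) (f : E → E′ → Carrier) →
           ∑[ xs ] (λ x → ∑[ ys ] (f x)) ≈ ∑[ ys ] (λ y → ∑[ xs ] (λ x → f x y))
  ∑-comm []       ys f = sym (∑-0 ys)
  ∑-comm (x ∷ xs) ys f = trans (+-congˡ (∑-comm xs ys f)) (sym (∑-+ ys _ _))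

  ∑-↭ : ∀ {xs ys : List E} f → xs ↭ ys → ∑[ xs ] f ≈ ∑[ ys ] f
  ∑-↭ f _↭_.refl         = refl
  ∑-↭ f (_↭_.prep x σ)   = +-congˡ (∑-↭ f σ)
  ∑-↭ f (_↭_.swap x y σ) = trans (+-congˡ (+-congˡ (∑-↭ f σ)))
    (solve 3 (λ a b d → a :+ (b :+ d) := b :+ (a :+ d)) refl _ _ _)
  ∑-↭ f (_↭_.trans σ τ)  = trans (∑-↭ f σ) (∑-↭ f τ)

  ∑-cuts-∷ : ∀ (y : E) w f →
             ∑[ cuts (y ∷ w) ] f ≡ f ([] , y ∷ w) + ∑[ cuts w ] (λ (u , v) → f (y ∷ u , v))
  ∑-cuts-∷ y w f = ≡.cong (f ([] , y ∷ w) +_) (∑-map (map₁ (y ∷_)) (cuts w) f)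

  -- The cut falls either before `y`, inside or at an end of `u`, or after `y`, inside or at an end
  -- of `v`.
  ∑-cuts-++ : ∀ (u : List E) y v f → ∑[ cuts (u ++ y ∷ v) ] f ≈
              ∑[ cuts u ] (λ (a , b) → f (a , b ++ y ∷ v)) +
              ∑[ cuts v ] (λ (a , b) → f (u ++ y ∷ a , b))
  ∑-cuts-++ []      y v f = begin
    ∑[ cuts (y ∷ v) ] f
      ≡⟨ ∑-cuts-∷ y v f ⟩
    f ([] , y ∷ v) + ∑[ cuts v ] (λ (a , b) → f (y ∷ a , b))
      ≈⟨ +-congʳ (+-identityʳ _) ⟨
    (f ([] , y ∷ v) + 0#) + ∑[ cuts v ] (λ (a , b) → f (y ∷ a , b)) ∎
  ∑-cuts-++ (z ∷ u) y v f = begin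
    ∑[ cuts (z ∷ u ++ y ∷ v) ] f
      ≡⟨ ∑-cuts-∷ z (u ++ y ∷ v) f ⟩
    f ([] , z ∷ u ++ y ∷ v) + ∑[ cuts (u ++ y ∷ v) ] (λ (a , b) → f (z ∷ a , b))
      ≈⟨ +-congˡ (∑-cuts-++ u y v (λ (a , b) → f (z ∷ a , b))) ⟩
    f ([] , z ∷ u ++ y ∷ v) +
      (∑[ cuts u ] (λ (a , b) → f (z ∷ a , b ++ y ∷ v)) +
       ∑[ cuts v ] (λ (a , b) → f (z ∷ u ++ y ∷ a , b)))
      ≈⟨ +-assoc _ _ _ ⟨
    f ([] , z ∷ u ++ y ∷ v) + ∑[ cuts u ] (λ (a , b) → f (z ∷ a , b ++ y ∷ v)) +
      ∑[ cuts v ] (λ (a , b) → f (z ∷ u ++ y ∷ a , b))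
      ≈⟨ +-congʳ (reflexive (∑-cuts-∷ z u (λ (a , b) → f (a , b ++ y ∷ v)))) ⟨
    ∑[ cuts (z ∷ u) ] (λ (a , b) → f (a , b ++ y ∷ v)) +
      ∑[ cuts v ] (λ (a , b) → f (z ∷ u ++ y ∷ a , b)) ∎

  -- Coassociativity of deconcatenation: both sides run over all factorisations of `w` into three
  -- words `a`, `b`, `d`.
  ∑-cuts-coassoc : ∀ (w : List E) (f : List E → List E → List E → Carrier) →
    ∑[ cuts w ] (λ (u , d) → ∑[ cuts u ] λ (a , b) → f a b d) ≈
    ∑[ cuts w ] (λ (a , v) → ∑[ cuts v ] λ (b , d) → f a b d)
  ∑-cuts-coassoc []      f = refl
  ∑-cuts-coassoc (z ∷ w) f = begin
    ∑[ cuts (z ∷ w) ] (λ (u , d) → ∑[ cuts u ] λ (a , b) → f a b d)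
      ≡⟨ ∑-cuts-∷ z w _ ⟩
    (f [] [] (z ∷ w) + 0#) + ∑[ cuts w ] (λ (u , d) → ∑[ cuts (z ∷ u) ] λ (a , b) → f a b d)
      ≈⟨ +-cong (+-identityʳ _) (∑-cong (cuts w) λ (u , d) → reflexive (∑-cuts-∷ z u _)) ⟩
    f [] [] (z ∷ w) +
      ∑[ cuts w ] (λ (u , d) → f [] (z ∷ u) d + ∑[ cuts u ] λ (a , b) → f (z ∷ a) b d)
      ≈⟨ +-congˡ (∑-+ (cuts w) _ _) ⟩
    f [] [] (z ∷ w) + (∑[ cuts w ] (λ (u , d) → f [] (z ∷ u) d) +
      ∑[ cuts w ] (λ (u , d) → ∑[ cuts u ] λ (a , b) → f (z ∷ a) b d))
      ≈⟨ +-assoc _ _ _ ⟨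
    (f [] [] (z ∷ w) + ∑[ cuts w ] (λ (u , d) → f [] (z ∷ u) d)) +
      ∑[ cuts w ] (λ (u , d) → ∑[ cuts u ] λ (a , b) → f (z ∷ a) b d)
      ≈⟨ +-cong (reflexive (≡.sym (∑-cuts-∷ z w _))) (∑-cuts-coassoc w (f ∘ (z ∷_))) ⟩
    ∑[ cuts (z ∷ w) ] (λ (b , d) → f [] b d) +
      ∑[ cuts w ] (λ (a , v) → ∑[ cuts v ] λ (b , d) → f (z ∷ a) b d)
      ≡⟨ ∑-cuts-∷ z w _ ⟨
    ∑[ cuts (z ∷ w) ] (λ (a , v) → ∑[ cuts v ] λ (b , d) → f a b d) ∎

  ∑-splits-∷ : ∀ (y : E) S f → ∑[ splits (y ∷ S) ] f ≈
               ∑[ splits S ] (λ (L , M) → f (y ∷ L , M)) + ∑[ splits S ] (λ (L , M) → f (L , y ∷ M))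
  ∑-splits-∷ y S f = trans (∑-++ (map (map₁ (y ∷_)) (splits S)) (map (map₂ (y ∷_)) (splits S)) f)
    (reflexive (≡.cong₂ _+_ (∑-map (map₁ (y ∷_)) (splits S) f)
                            (∑-map (map₂ (y ∷_)) (splits S) f)))

  ∑-splits-comm : ∀ (S : List E) f → ∑[ splits S ] f ≈ ∑[ splits S ] (λ (L , M) → f (M , L))
  ∑-splits-comm []      f = refl
  ∑-splits-comm (y ∷ S) f = begin
    ∑[ splits (y ∷ S) ] f
      ≈⟨ ∑-splits-∷ y S f ⟩
    ∑[ splits S ] (λ (L , M) → f (y ∷ L , M)) + ∑[ splits S ] (λ (L , M) → f (L , y ∷ M))
      ≈⟨ +-cong (∑-splits-comm S _) (∑-splits-comm S _) ⟩
    ∑[ splits S ] (λ (L , M) → f (y ∷ M , L)) + ∑[ splits S ] (λ (L , M) → f (M , y ∷ L))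
      ≈⟨ +-comm _ _ ⟩
    ∑[ splits S ] (λ (L , M) → f (M , y ∷ L)) + ∑[ splits S ] (λ (L , M) → f (y ∷ M , L))
      ≈⟨ ∑-splits-∷ y S (λ (L , M) → f (M , L)) ⟨
    ∑[ splits (y ∷ S) ] (λ (L , M) → f (M , L)) ∎

  ∑-arrangements-∷ : ∀ (x : E) S f → ∑[ arrangements (x ∷ S) ] f ≈
                     ∑[ arrangements S ] (λ w → ∑[ cuts w ] λ (u , v) → f (u ++ x ∷ v))
  ∑-arrangements-∷ x S f = trans (∑-concatMap (insertions x) (arrangements S) f)
    (∑-cong (arrangements S) λ w → reflexive (∑-map _ (cuts w) f))

  -- Cutting an arrangement in two amounts to choosing the letters of each piece and arranging the
  -- pieces independently. In the induction, inserting `y` and then cutting is traded for cutting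
  -- and then inserting `y` into one of the pieces.
  ∑-arrangements-cuts : ∀ (S : List E) f →
    ∑[ arrangements S ] (λ w → ∑[ cuts w ] f) ≈
    ∑[ splits S ] (λ (L , M) → ∑[ arrangements L ] λ u → ∑[ arrangements M ] λ v → f (u , v))
  ∑-arrangements-cuts []      f = +-congʳ (sym (+-identityʳ _))
  ∑-arrangements-cuts (y ∷ S) f = begin
    ∑[ arrangements (y ∷ S) ] (λ w → ∑[ cuts w ] f)
      ≈⟨ ∑-arrangements-∷ y S _ ⟩
    ∑[ arrangements S ] (λ w → ∑[ cuts w ] λ (u , v) → ∑[ cuts (u ++ y ∷ v) ] f)
      ≈⟨ ∑-cong (arrangements S) insert-then-cut ⟩
    ∑[ arrangements S ] (λ w → ∑[ cuts w ] cut-then-insert)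
      ≈⟨ ∑-arrangements-cuts S cut-then-insert ⟩
    ∑[ splits S ] (λ (L , M) → ∑[ arrangements L ] λ u → ∑[ arrangements M ] λ v →
      cut-then-insert (u , v))
      ≈⟨ ∑-cong (splits S) (λ (L , M) → separate L M) ⟩
    ∑[ splits S ] (λ (L , M) → double (y ∷ L) M + double L (y ∷ M))
      ≈⟨ ∑-+ (splits S) _ _ ⟩
    ∑[ splits S ] (λ (L , M) → double (y ∷ L) M) + ∑[ splits S ] (λ (L , M) → double L (y ∷ M))
      ≈⟨ ∑-splits-∷ y S (λ (L , M) → double L M) ⟨
    ∑[ splits (y ∷ S) ] (λ (L , M) → double L M) ∎
    where
    double : List _ → List _ → Carrier
    double L M = ∑[ arrangements L ] λ u → ∑[ arrangements M ] λ v → f (u , v)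

    insert-left insert-right cut-then-insert : List _ × List _ → Carrier
    insert-left  (u , v) = ∑[ cuts u ] λ (a , b) → f (a ++ y ∷ b , v)
    insert-right (u , v) = ∑[ cuts v ] λ (b , d) → f (u , b ++ y ∷ d)
    cut-then-insert (u , v) = insert-left (u , v) + insert-right (u , v)

    insert-then-cut : ∀ w → ∑[ cuts w ] (λ (u , v) → ∑[ cuts (u ++ y ∷ v) ] f) ≈
                            ∑[ cuts w ] cut-then-insert
    insert-then-cut w = begin
      ∑[ cuts w ] (λ (u , v) → ∑[ cuts (u ++ y ∷ v) ] f)
        ≈⟨ trans (∑-cong (cuts w) λ (u , v) → ∑-cuts-++ u y v f) (∑-+ (cuts w) _ _) ⟩
      ∑[ cuts w ] (λ (u , v) → ∑[ cuts u ] λ (a , b) → f (a , b ++ y ∷ v)) +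
        ∑[ cuts w ] (λ (u , v) → ∑[ cuts v ] λ (a , b) → f (u ++ y ∷ a , b))
        -- With w factored as `a`, `b`, `d`, a cut before `y` reads a | b y d and a cut after `y`
        -- reads a y b | d. Coassociativity makes the bar the outer cut of `w` and the place of `y`
        -- the inner one.
        ≈⟨ +-cong (∑-cuts-coassoc w λ a b d → f (a , b ++ y ∷ d))
                  (sym (∑-cuts-coassoc w λ a b d → f (a ++ y ∷ b , d))) ⟩
      ∑[ cuts w ] insert-right + ∑[ cuts w ] insert-left
        ≈⟨ +-comm _ _ ⟩
      ∑[ cuts w ] insert-left + ∑[ cuts w ] insert-right
        ≈⟨ ∑-+ (cuts w) _ _ ⟨
      ∑[ cuts w ] cut-then-insert ∎

    separate : ∀ L M → ∑[ arrangements L ] (λ u → ∑[ arrangements M ] λ v → cut-then-insert (u , v))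
                       ≈ double (y ∷ L) M + double L (y ∷ M)
    separate L M = begin
      ∑[ arrangements L ] (λ u → ∑[ arrangements M ] λ v → cut-then-insert (u , v))
        ≈⟨ trans (∑-cong (arrangements L) λ u → ∑-+ (arrangements M) _ _)
                 (∑-+ (arrangements L) _ _) ⟩
      ∑[ arrangements L ] (λ u → ∑[ arrangements M ] λ v → insert-left (u , v)) +
        ∑[ arrangements L ] (λ u → ∑[ arrangements M ] λ v → insert-right (u , v))
        ≈⟨ +-cong
             (trans (∑-cong (arrangements L) λ u → ∑-comm (arrangements M) (cuts u) _)
                    (sym (∑-arrangements-∷ y L _)))
             (∑-cong (arrangements L) λ u → sym (∑-arrangements-∷ y M _)) ⟩
      double (y ∷ L) M + double L (y ∷ M) ∎

-- Weighted sums over permutations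

module Weighted (R : CommutativeRing c ℓ) (r Y T : CommutativeRing.Carrier R) where
  open CommutativeRing R
  open Polynomials R using (∑[_])
  open Summation R
  open Exp commutativeSemiring
  open NatSolver commutativeSemiring using (solve; _:=_; _:+_; _:*_; con)
  open SetoidReasoning setoid

  monomial : ℕ → ℕ → ℕ → Carrier
  monomial k p d = r ^ suc k * (Y ^ (p ℕ.+ 1) * T ^ (d ℕ.+ 1))

  weight : ∀ {m} → List (Fin m) → Carrier
  weight w = monomial (length w) (pk w) (des w)

  total : ∀ {m} → List (Fin m) → Carrier
  total S = ∑[ arrangements S ] weight

  -- A maximum between two nonempty words adds one to the length, to the peaks and to the descents;
  -- the shift by one in all three exponents absorbs exactly this.
  monomial-* : ∀ k p d k′ p′ d′ →
    monomial (k ℕ.+ suc k′) (p ℕ.+ suc p′) (d ℕ.+ suc d′) ≈ monomial k p d * monomial k′ p′ d′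
  monomial-* k p d k′ p′ d′ = begin
    r * r ^ (k ℕ.+ suc k′) * (Y ^ (p ℕ.+ suc p′ ℕ.+ 1) * T ^ (d ℕ.+ suc d′ ℕ.+ 1))
      ≈⟨ *-cong (*-congˡ (^-homo-* r k (suc k′))) (*-cong (split Y p p′) (split T d d′)) ⟩
    r * (r ^ k * r ^ suc k′) * (Y ^ (p ℕ.+ 1) * Y ^ (p′ ℕ.+ 1) * (T ^ (d ℕ.+ 1) * T ^ (d′ ℕ.+ 1)))
      ≈⟨ solve 7 (λ r a b c d e f → r :* (a :* b) :* (c :* d :* (e :* f))
                                 := r :* a :* (c :* e) :* (b :* (d :* f))) refl _ _ _ _ _ _ _ ⟩
    monomial k p d * monomial k′ p′ d′ ∎
    where
    split : ∀ x i j → x ^ (i ℕ.+ suc j ℕ.+ 1) ≈ x ^ (i ℕ.+ 1) * x ^ (j ℕ.+ 1)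
    split x i j = trans
      (^-congʳ x (≡.trans (≡.cong (ℕ._+ 1) (≡.trans (ℕ.+-suc i j) (≡.cong (ℕ._+ j) (ℕ.+-comm 1 i))))
                          (ℕ.+-assoc (i ℕ.+ 1) j 1)))
      (^-homo-* x (i ℕ.+ 1) (j ℕ.+ 1))

  module _ {m} (x : Fin m) where

    weight-insert-max : ∀ a u b v → All (Fin._< x) (a ∷ u) → All (Fin._< x) (b ∷ v) →
                        weight (a ∷ u ++ x ∷ b ∷ v) ≈ weight (a ∷ u) * weight (b ∷ v)
    weight-insert-max a u b v u< v<
      rewrite List.length-++ u {x ∷ b ∷ v}
            | pk-insert-max x a u b v u< v< | des-insert-max x a u b v u< v<
      = monomial-* (length (a ∷ u)) (pk (a ∷ u)) (des (a ∷ u))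
                   (length (b ∷ v)) (pk (b ∷ v)) (des (b ∷ v))

    weight-∷ʳ-max : ∀ a u → All (Fin._< x) (a ∷ u) → weight (a ∷ u ++ [ x ]) ≈ r * weight (a ∷ u)
    weight-∷ʳ-max a u u<
      rewrite List.length-++ u {[ x ]} | ℕ.+-comm (length u) 1
            | pk-∷ʳ-max x a u u< | des-∷ʳ-max x a u u<
      = *-assoc _ _ _

    weight-max-∷ : ∀ b v → All (Fin._< x) (b ∷ v) → weight (x ∷ b ∷ v) ≈ r * T * weight (b ∷ v)
    weight-max-∷ b v v< rewrite pk-max-∷ x b v v< | des-max-∷ x b v v< =
      solve 5 (λ r t a y d → r :* a :* (y :* (t :* d)) := r :* t :* (a :* (y :* d)))
        refl r T _ _ _

    total-singleton : total [ x ] ≈ r * r * (Y * T)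
    total-singleton = solve 3
      (λ r y t → r :* (r :* con 1) :* ((y :* con 1) :* (t :* con 1)) :+ con 0
              := r :* r :* (y :* t)) refl r Y T

    -- The contributions of the splits (L , M) and (M , L) of the letters below x.
    paired : List (Fin m) → List (Fin m) → Carrier
    paired L []        = (r + r * T) * total L
    paired L M@(_ ∷ _) = total L * total M + total M * total L

    private
      joined : List (Fin m) → List (Fin m) → Carrier
      joined L M = ∑[ arrangements L ] λ u → ∑[ arrangements M ] λ v → weight (u ++ x ∷ v)

      -- The permutation is recorded to exclude the empty word when `L` is nonempty, since
      -- multiplicativity of the weight fails there.
      arrangements-<x : ∀ (L : List (Fin m)) → All (Fin._< x) L →
                        All (λ w → w ↭ L × All (Fin._< x) w) (arrangements L)
      arrangements-<x L L< = All.tabulate λ w∈ →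
        let w↭L = ∈-arrangements⁻ L w∈ in w↭L , Perm.All-resp-↭ (↭-sym w↭L) L<

      joined-∷-[] : ∀ y (L : List (Fin m)) → All (Fin._< x) (y ∷ L) →
                    joined (y ∷ L) [] ≈ r * total (y ∷ L)
      joined-∷-[] y L L< = trans
        (∑-cong-All (All.map (λ { {[]}    (σ , _)  → contradiction (↭-sym σ) Perm.¬x∷xs↭[]
                                ; {a ∷ u} (_ , u<) → trans (+-identityʳ _) (weight-∷ʳ-max a u u<) })
                             (arrangements-<x (y ∷ L) L<)))
        (∑-*ˡ (arrangements (y ∷ L)) r weight)

      joined-[]-∷ : ∀ y (L : List (Fin m)) → All (Fin._< x) (y ∷ L) →
                    joined [] (y ∷ L) ≈ r * T * total (y ∷ L)
      joined-[]-∷ y L L< = trans (+-identityʳ _) (trans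
        (∑-cong-All (All.map (λ { {[]}    (σ , _)  → contradiction (↭-sym σ) Perm.¬x∷xs↭[]
                                ; {b ∷ v} (_ , v<) → weight-max-∷ b v v< })
                             (arrangements-<x (y ∷ L) L<)))
        (∑-*ˡ (arrangements (y ∷ L)) (r * T) weight))

      joined-∷-∷ : ∀ y (L : List (Fin m)) z M → All (Fin._< x) (y ∷ L) → All (Fin._< x) (z ∷ M) →
                   joined (y ∷ L) (z ∷ M) ≈ total (y ∷ L) * total (z ∷ M)
      joined-∷-∷ y L z M L< M< = trans
        (∑-cong-All (All.map
          (λ { {[]}    (σ , _)  → contradiction (↭-sym σ) Perm.¬x∷xs↭[]
             ; {a ∷ u} (_ , u<) → trans
                 (∑-cong-All (All.map
                   (λ { {[]}    (σ , _)  → contradiction (↭-sym σ) Perm.¬x∷xs↭[]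
                      ; {b ∷ v} (_ , v<) → weight-insert-max a u b v u< v< })
                   (arrangements-<x (z ∷ M) M<)))
                 (∑-*ˡ (arrangements (z ∷ M)) (weight (a ∷ u)) weight) })
          (arrangements-<x (y ∷ L) L<)))
        (∑-*ʳ (arrangements (y ∷ L)) (total (z ∷ M)) weight)

      joined-paired : ∀ y (L M : List (Fin m)) → All (Fin._< x) (y ∷ L) → All (Fin._< x) M →
                      joined (y ∷ L) M + joined M (y ∷ L) ≈ paired (y ∷ L) M
      joined-paired y L []      L< _  = trans (+-cong (joined-∷-[] y L L<) (joined-[]-∷ y L L<))
                                              (sym (distribʳ _ _ _))
      joined-paired y L (z ∷ M) L< M< =
        +-cong (joined-∷-∷ y L z M L< M<) (joined-∷-∷ z M y L M< L<)

    -- Every split of `y ∷ S` has `y` on exactly one side, so it is matched with its mirror image by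
    -- taking `y` on the left as representative.
    total-∷-∷ : ∀ y S → All (Fin._< x) (y ∷ S) →
                total (x ∷ y ∷ S) ≈ ∑[ splits S ] (λ (L , M) → paired (y ∷ L) M)
    total-∷-∷ y S (y< ∷ S<) = begin
      total (x ∷ y ∷ S)
        ≈⟨ ∑-arrangements-∷ x (y ∷ S) weight ⟩
      ∑[ arrangements (y ∷ S) ] (λ w → ∑[ cuts w ] λ (u , v) → weight (u ++ x ∷ v))
        ≈⟨ ∑-arrangements-cuts (y ∷ S) _ ⟩
      ∑[ splits (y ∷ S) ] (λ (L , M) → joined L M)
        ≈⟨ ∑-splits-∷ y S _ ⟩
      ∑[ splits S ] (λ (L , M) → joined (y ∷ L) M) + ∑[ splits S ] (λ (L , M) → joined L (y ∷ M))
        ≈⟨ +-congˡ (∑-splits-comm S _) ⟩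
      ∑[ splits S ] (λ (L , M) → joined (y ∷ L) M) + ∑[ splits S ] (λ (L , M) → joined M (y ∷ L))
        ≈⟨ ∑-+ (splits S) _ _ ⟨
      ∑[ splits S ] (λ (L , M) → joined (y ∷ L) M + joined M (y ∷ L))
        ≈⟨ ∑-cong-All (All.map (λ {(L , M)} (σ , τ) →
             joined-paired y L M (y< ∷ All-resp-⊆ σ S<) (All-resp-⊆ τ S<)) (splits-⊆ S)) ⟩
      ∑[ splits S ] (λ (L , M) → paired (y ∷ L) M) ∎

-- Invariance of the weighted totals

module Invariance (R : CommutativeRing c ℓ) where
  open CommutativeRing R
  open Polynomials R
  open Summation R
  open Exp commutativeSemiring
  open SetoidReasoning setoid

  module _ (r Y T r′ Y′ T′ : Carrier) (r+rT : r + r * T ≈ r′ + r′ * T′)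
           (rrYT : r * r * (Y * T) ≈ r′ * r′ * (Y′ * T′)) where
    private
      module W  = Weighted R r Y T
      module W′ = Weighted R r′ Y′ T′

    -- Induction on a bound for the length, because the recursion passes to sublists. The letter `y`
    -- keeps one half nonempty; an empty other half enters only through the factor r + r T, so the
    -- total of the empty list never has to be compared.
    total-invariant : ∀ {m} k x (S : List (Fin m)) → length S ℕ.≤ k → AllPairs Fin._>_ (x ∷ S) →
                      W.total (x ∷ S) ≈ W′.total (x ∷ S)
    total-invariant k       x []      _           _           =
      trans (W.total-singleton x) (trans rrYT (sym (W′.total-singleton x)))
    total-invariant (suc k) x (y ∷ S) (s≤s |S|≤k) (S<x ∷ S<y ∷ S>) = begin
      W.total (x ∷ y ∷ S)
        ≈⟨ W.total-∷-∷ x y S S<x ⟩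
      ∑[ splits S ] (λ (L , M) → W.paired x (y ∷ L) M)
        ≈⟨ ∑-cong-All (All.map (λ {(L , M)} (σ , τ) → paired-invariant L M σ τ) (splits-⊆ S)) ⟩
      ∑[ splits S ] (λ (L , M) → W′.paired x (y ∷ L) M)
        ≈⟨ W′.total-∷-∷ x y S S<x ⟨
      W′.total (x ∷ y ∷ S) ∎
      where
      total-y∷ : ∀ L → L ⊆ S → W.total (y ∷ L) ≈ W′.total (y ∷ L)
      total-y∷ L σ = total-invariant k y L (ℕ.≤-trans (length-mono-≤ σ) |S|≤k)
                       (All-resp-⊆ σ S<y ∷ AllPairs-resp-⊆ σ S>)

      total-∷ : ∀ z M → z ∷ M ⊆ S → W.total (z ∷ M) ≈ W′.total (z ∷ M)
      total-∷ z M τ = total-invariant k z M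
        (ℕ.≤-trans (ℕ.n≤1+n _) (ℕ.≤-trans (length-mono-≤ τ) |S|≤k)) (AllPairs-resp-⊆ τ S>)

      paired-invariant : ∀ L M → L ⊆ S → M ⊆ S → W.paired x (y ∷ L) M ≈ W′.paired x (y ∷ L) M
      paired-invariant L []      σ _ = *-cong r+rT (total-y∷ L σ)
      paired-invariant L (z ∷ M) σ τ = +-cong (*-cong (total-y∷ L σ) (total-∷ z M τ))
                                              (*-cong (total-∷ z M τ) (total-y∷ L σ))

    Ppk,des-invariant : ∀ n → n ≥ 1 → r ^ suc n * Ppk,des n Y T ≈ r′ ^ suc n * Ppk,des n Y′ T′
    Ppk,des-invariant n@(suc _) _ = begin
      r ^ suc n * Ppk,des n Y T
        ≈⟨ as-total r Y T ⟨
      W.total (descending n)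
        ≈⟨ total-invariant _ _ _ ℕ.≤-refl (descending-decreasing n) ⟩
      W′.total (descending n)
        ≈⟨ as-total r′ Y′ T′ ⟩
      r′ ^ suc n * Ppk,des n Y′ T′ ∎
      where
      as-total : ∀ r Y T → Weighted.total R r Y T (descending n) ≈ r ^ suc n * Ppk,des n Y T
      as-total r Y T = begin
        Weighted.total R r Y T (descending n)
          ≈⟨ ∑-cong-All (All.tabulate λ {w} w∈ → *-congʳ (^-congʳ r {suc (length w)} {suc n}
               (≡.cong suc (≡.trans (Perm.↭-length (∈-arrangements⁻ (descending n) w∈))
                                    (List.length-tabulate opposite))))) ⟩
        ∑[ arrangements (descending n) ] (λ w → r ^ suc n * (Y ^ (pk w ℕ.+ 1) * T ^ (des w ℕ.+ 1)))
          ≈⟨ ∑-↭ _ (𝔖↭arrangements n) ⟨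
        ∑[ 𝔖 n ] (λ w → r ^ suc n * (Y ^ (pk w ℕ.+ 1) * T ^ (des w ℕ.+ 1)))
          ≈⟨ ∑-*ˡ (𝔖 n) (r ^ suc n) _ ⟩
        r ^ suc n * Ppk,des n Y T ∎

  private
    1^*-identityˡ : ∀ k x → 1# ^ k * x ≈ x
    1^*-identityˡ zero    x = *-identityˡ x
    1^*-identityˡ (suc k) x = trans (*-congʳ (*-identityˡ _)) (1^*-identityˡ k x)

  A≈Ppk,des : ∀ n t → A n t ≈ Ppk,des n 1# t
  A≈Ppk,des n t = ∑-cong (𝔖 n) λ w → sym (1^*-identityˡ (pk w ℕ.+ 1) _)

  -- Invariance between the parameters (r, Y, T) and (1, 1, t).
  A≈r^*Ppk,des : ∀ n → n ≥ 1 → ∀ t r Y T → r + r * T ≈ 1# + t → r * r * (Y * T) ≈ t →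
                 A n t ≈ r ^ suc n * Ppk,des n Y T
  A≈r^*Ppk,des n n≥1 t r Y T r+rT rrYT = begin
    A n t                         ≈⟨ A≈Ppk,des n t ⟩
    Ppk,des n 1# t                ≈⟨ 1^*-identityˡ (suc n) _ ⟨
    1# ^ suc n * Ppk,des n 1# t   ≈⟨ Ppk,des-invariant r Y T 1# 1# t
                                       (trans r+rT (+-congˡ (sym (*-identityˡ t))))
                                       (trans rrYT (sym (trans
                                         (*-cong (*-identityˡ 1#) (*-identityˡ t)) (*-identityˡ t))))
                                       n n≥1 ⟨
    r ^ suc n * Ppk,des n Y T     ∎

  -- Invariance between the parameters (1, y, t) and (r, 1, v).
  Ppk,des≈r^*A : ∀ n → n ≥ 1 → ∀ y t r v → r + r * v ≈ 1# + t → r * r * v ≈ y * t →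
                 Ppk,des n y t ≈ r ^ suc n * A n v
  Ppk,des≈r^*A n n≥1 y t r v r+rv rrv = begin
    Ppk,des n y t                 ≈⟨ 1^*-identityˡ (suc n) _ ⟨
    1# ^ suc n * Ppk,des n y t    ≈⟨ Ppk,des-invariant r 1# v 1# y t
                                       (trans r+rv (+-congˡ (sym (*-identityˡ t))))
                                       (trans (*-congˡ (*-identityˡ v)) (trans rrv
                                         (sym (trans (*-congʳ (*-identityˡ 1#)) (*-identityˡ _)))))
                                       n n≥1 ⟨
    r ^ suc n * Ppk,des n 1# v    ≈⟨ *-congˡ (A≈Ppk,des n v) ⟨
    r ^ suc n * A n v             ∎

module Quotients (R : CommutativeRing c ℓ) (D : IsIntegralDomain R) where
  open CommutativeRing R
  open Polynomials R using (A; Ppk,des)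
  open Exp commutativeSemiring using (_^_)
  open Regularity R

  A≈quotients : ∀ n → n ≥ 1 → ∀ t {a b c d e r Y T} →
                IsQuotient b a r → IsQuotient c e Y → IsQuotient d b T →
                c ≈ a ^ 2 * t → e ≈ d * b → b + d ≈ a * (1# + t) →
                A n t ≈ r ^ suc n * Ppk,des n Y T
  A≈quotients n n≥1 t {r = r} {Y} {T} (quotient a≉0 r-eq) (quotient _ Y-eq) (quotient _ T-eq)
              c-eq e-eq b+d-eq =
    Invariance.A≈r^*Ppk,des R n n≥1 t r Y T
      (r+rT≈1+t (domain-regular D a≉0) r-eq T-eq b+d-eq)
      (rrYT≈t (domain-regular D a≉0) r-eq T-eq Y-eq c-eq e-eq)

-- The first identity

-- Opening a parametrised module makes fresh copies of its names, and comparing terms over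
-- different copies unfolds all the field arithmetic.  Hence there is a single copy; general
-- results are transferred to it with variables in place of rational functions, and the
-- rational functions are written out in signatures only.
module ℚ⟨y,t⟩ = RationalFunctionField ℚ-ring ℚ-isIntegralDomain

module FirstIdentity where
  open ℚ⟨y,t⟩
  private
    module F = FractionField (Polynomial.commutativeRing (Polynomial.commutativeRing ℚ-ring))
      (Polynomial.isIntegralDomain (Polynomial.commutativeRing ℚ-ring)
        (Polynomial.isIntegralDomain ℚ-ring ℚ-isIntegralDomain))
    module Reg = Regularity F.commutativeRing
  open Reg using (IsQuotient; quotient)

  /-isQuotient : ∀ a b b≉0 → IsQuotient a b (a / b [ b≉0 ])
  /-isQuotient a b b≉0 = quotient b≉0 (F./-*-cancel a b b≉0)

  A≈quotients : ∀ n → n ≥ 1 → ∀ {t a b c d e r Y T} →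
                IsQuotient b a r → IsQuotient c e Y → IsQuotient d b T →
                c ≈ a ^ 2 * t → e ≈ d * b → b + d ≈ a * (1# + t) →
                A n t ≈ (r ^ suc n) * Ppk,des n Y T
  A≈quotients n n≥1 {t} {a} {b} {c} {d} {e} {r} {Y} {T} =
    Quotients.A≈quotients F.commutativeRing F.isIntegralDomain n n≥1 t
      {a} {b} {c} {d} {e} {r} {Y} {T}

  ≈-refl : ∀ {x} → x ≈ x
  ≈-refl = CommutativeRing.refl F.commutativeRing

  factorisation : ∀ y t → (1# + y * t) + (y + t) ≈ (1# + y) * (1# + t)
  factorisation = Reg.factorisation

  r-isQuotient : IsQuotient (1# + y * t) (1# + y) ((1# + y * t) / (1# + y) [ 1+y≉0 ])
  r-isQuotient = /-isQuotient _ _ 1+y≉0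

  denominator≉0 : ¬ ((y + t) * (1# + y * t) ≈ 0#)
  denominator≉0 = [y+t][1+yt]≉0

  Y-isQuotient : IsQuotient ((1# + y) ^ 2 * t) ((y + t) * (1# + y * t))
                   (((1# + y) ^ 2 * t) / ((y + t) * (1# + y * t)) [ [y+t][1+yt]≉0 ])
  Y-isQuotient = /-isQuotient _ _ denominator≉0

  T-isQuotient : IsQuotient (y + t) (1# + y * t) ((y + t) / (1# + y * t) [ 1+yt≉0 ])
  T-isQuotient = /-isQuotient _ _ 1+yt≉0

  factorisation-y-t : (1# + y * t) + (y + t) ≈ (1# + y) * (1# + t)
  factorisation-y-t = factorisation y t

  first-identity : ∀ n → n ≥ 1 →
    A n t ≈ (((1# + y * t) / (1# + y) [ 1+y≉0 ]) ^ suc n)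
            * Ppk,des n (((1# + y) ^ 2 * t) / ((y + t) * (1# + y * t)) [ [y+t][1+yt]≉0 ])
                        ((y + t) / (1# + y * t) [ 1+yt≉0 ])
  first-identity n n≥1 =
    A≈quotients n n≥1 r-isQuotient Y-isQuotient T-isQuotient ≈-refl ≈-refl factorisation-y-t

-- The second identity

module SubstitutionIdentities (R : CommutativeRing c ℓ) (y t : CommutativeRing.Carrier R) where
  open CommutativeRing R
  open Exp commutativeSemiring using (_^_)
  open IntegerCoefficients R
  open Regularity R
  open RingProperties ring using (x∙y⁻¹≈ε⇒x≈y)

  2# 4# uDen vDen : Carrier
  2# = 1# + 1#
  4# = 2# + 2#
  uDen = 2# * (1# - y) * t
  vDen = 2# * y * t

  discriminant : Carrier
  discriminant = (1# + t) ^ 2 - 4# * y * t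

  uNum vNum : Carrier → Carrier
  uNum s = 1# + t ^ 2 - 2# * y * t - (1# - t) * s
  vNum s = (1# + t) ^ 2 - 2# * y * t - (1# + t) * s

  private
    module Syntax {n : ℕ} where
      one two four : Polynomial n
      one  = con (pos 1)
      two  = one :+ one
      four = two :+ two

      uDenᵖ vDenᵖ discriminantᵖ : (y t : Polynomial n) → Polynomial n
      uDenᵖ y t = two :* (one :- y) :* t
      vDenᵖ y t = two :* y :* t
      discriminantᵖ y t = (one :+ t) :^ 2 :- four :* y :* t

      uNumᵖ vNumᵖ : (y t s : Polynomial n) → Polynomial n
      uNumᵖ y t s = one :+ t :^ 2 :- two :* y :* t :- (one :- t) :* s
      vNumᵖ y t s = (one :+ t) :^ 2 :- two :* y :* t :- (one :+ t) :* s
    open Syntax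

  module Denominators (2-regular : Regular 2#) (y-regular : Regular y)
                      (1-y-regular : Regular (1# - y)) (t-regular : Regular t) where

    uDen-regular : Regular uDen
    uDen-regular = regular-* (regular-* 2-regular 1-y-regular) t-regular

    vDen-regular : Regular vDen
    vDen-regular = regular-* (regular-* 2-regular y-regular) t-regular

  -- 2r = 1 + t + s, v = (1 + t - s) / (1 + t + s) and u = (s - 1 + t) / (s + 1 - t).
  module Parameters
    (2-regular : Regular 2#) (uDen-regular : Regular uDen) (vDen-regular : Regular vDen)
    (s u v r : Carrier) (s-regular : Regular s)
    (s-eq : s ^ 2 ≈ discriminant)
    (u-eq : u * uDen ≈ uNum s)
    (v-eq : v * vDen ≈ vNum s)
    (r-eq : r * (1# + u * v) ≈ 1# + u) where

    -- Substituting the value of s² gives 2 `uNum` = (s - 1 + t)² and 2 `uDen` = (s - 1 + t)(s + 1 -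
    -- t).
    [s+1-t]u≈s-1+t : (s + 1# - t) * u ≈ s - 1# + t
    [s+1-t]u≈s-1+t = regular-cancel (regular-* 2-regular uDen-regular) (trans
      (solve 4 (λ y t s u →
        two :* uDenᵖ y t :* ((s :+ one :- t) :* u :- (s :- one :+ t)) :=
        two :* (s :+ one :- t) :* (u :* uDenᵖ y t :- uNumᵖ y t s) :+
        (con (pos 2) :* (t :- one) :* (s :^ 2 :- discriminantᵖ y t) :+ con (pos 0)))
        refl y t s u)
      (2# * (s + 1# - t) ∙ u-eq ⊕ 2# * (t - 1#) ∙ s-eq ⊕ refl))

    -- Substituting the value of s² gives 2 `vNum` = (1 + t - s)² and 2 `vDen` = (1 + t - s)(1 + t +
    -- s).
    [1+t+s]v≈1+t-s : (1# + t + s) * v ≈ 1# + t - s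
    [1+t+s]v≈1+t-s = regular-cancel (regular-* 2-regular vDen-regular) (trans
      (solve 4 (λ y t s v →
        two :* vDenᵖ y t :* ((one :+ t :+ s) :* v :- (one :+ t :- s)) :=
        two :* (one :+ t :+ s) :* (v :* vDenᵖ y t :- vNumᵖ y t s) :+
        (:- (two :* (one :+ t)) :* (s :^ 2 :- discriminantᵖ y t) :+ con (pos 0)))
        refl y t s v)
      (2# * (1# + t + s) ∙ v-eq ⊕ - (2# * (1# + t)) ∙ s-eq ⊕ refl))

    -- Here 1 + u = 2s/(s + 1 - t) and 1 + u v = 4s/((s + 1 - t)(1 + t + s)); the common factor s is
    -- why s must be regular.
    2r≈1+t+s : 2# * r ≈ 1# + t + s
    2r≈1+t+s = regular-cancel (regular-* 2-regular s-regular) (trans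
      (solve 5 (λ t s u v r →
        two :* s :* (two :* r :- (one :+ t :+ s)) :=
        (s :+ one :- t) :* (one :+ t :+ s) :* (r :* (one :+ u :* v) :- (one :+ u)) :+
        ((one :+ t :+ s) :* (one :- r :* v) :* ((s :+ one :- t) :* u :- (s :- one :+ t)) :+
        (:- (r :* (s :- one :+ t)) :* ((one :+ t :+ s) :* v :- (one :+ t :- s)) :+ con (pos 0))))
        refl t s u v r)
      ((s + 1# - t) * (1# + t + s) ∙ r-eq
        ⊕ (1# + t + s) * (1# - r * v) ∙ [s+1-t]u≈s-1+t
        ⊕ - (r * (s - 1# + t)) ∙ [1+t+s]v≈1+t-s ⊕ refl))

    -- Since 2 r = 1 + t + s and 2 r v = 1 + t - s, the elements r and r v have sum 1 + t and
    -- product ((1 + t)² - s²)/4 = y t.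
    r+rv≈1+t : r + r * v ≈ 1# + t
    r+rv≈1+t = regular-cancel 2-regular (trans
      (solve 4 (λ t s v r →
        two :* (r :+ r :* v :- (one :+ t)) :=
        (one :+ v) :* (two :* r :- (one :+ t :+ s)) :+
        (one :* ((one :+ t :+ s) :* v :- (one :+ t :- s)) :+ con (pos 0)))
        refl t s v r)
      ((1# + v) ∙ 2r≈1+t+s ⊕ 1# ∙ [1+t+s]v≈1+t-s ⊕ refl))

    rrv≈yt : r * r * v ≈ y * t
    rrv≈yt = regular-cancel (regular-* 2-regular 2-regular) (trans
      (solve 5 (λ y t s v r →
        two :* two :* (r :* r :* v :- y :* t) :=
        (two :* r :+ (one :+ t :+ s)) :* v :* (two :* r :- (one :+ t :+ s)) :+
        ((one :+ t :+ s) :* ((one :+ t :+ s) :* v :- (one :+ t :- s)) :+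
        (:- one :* (s :^ 2 :- discriminantᵖ y t) :+ con (pos 0))))
        refl y t s v r)
      ((2# * r + (1# + t + s)) * v ∙ 2r≈1+t+s
        ⊕ (1# + t + s) ∙ [1+t+s]v≈1+t-s ⊕ - 1# ∙ s-eq ⊕ refl))

  -- w = t w₁ is the root 1 + t - r of the quadratic w (1 + t - w) = y t.
  module Construction
    (w₁ u v : Carrier)
    (w₁-eq : w₁ ≈ y + t * (- 1# * w₁ + 1# * (w₁ * w₁)))
    (u-eq : u ≈ t * (1# - w₁) + t * (w₁ * u + 0# * (u * u)))
    (v-eq : v ≈ t * w₁ + t * ((w₁ - 1#) * v + 0# * (v * v))) where

    w s r : Carrier
    w = t * w₁
    s = 1# + t - 2# * w
    r = 1# + t - w

    private
      module Syntax′ {n : ℕ} where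
        w₁-rhs : (y t w₁ : Polynomial n) → Polynomial n
        w₁-rhs y t w₁ = y :+ t :* (:- one :* w₁ :+ one :* (w₁ :* w₁))
        u-rhs v-rhs : (t w₁ x : Polynomial n) → Polynomial n
        u-rhs t w₁ u = t :* (one :- w₁) :+ t :* (w₁ :* u :+ con (pos 0) :* (u :* u))
        v-rhs t w₁ v = t :* w₁ :+ t :* ((w₁ :- one) :* v :+ con (pos 0) :* (v :* v))
        sᵖ : (t w₁ : Polynomial n) → Polynomial n
        sᵖ t w₁ = one :+ t :- two :* (t :* w₁)
      open Syntax′

    s^2≈discriminant : s ^ 2 ≈ discriminant
    s^2≈discriminant = x∙y⁻¹≈ε⇒x≈y _ _ (trans
      (solve 3 (λ y t w₁ →
        sᵖ t w₁ :^ 2 :- discriminantᵖ y t :=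
        :- (four :* t) :* (w₁ :- w₁-rhs y t w₁) :+ con (pos 0))
        refl y t w₁)
      (- (4# * t) ∙ w₁-eq ⊕ refl))

    u*uDen≈uNum : u * uDen ≈ uNum s
    u*uDen≈uNum = x∙y⁻¹≈ε⇒x≈y _ _ (trans
      (solve 4 (λ y t w₁ u →
        u :* uDenᵖ y t :- uNumᵖ y t (sᵖ t w₁) :=
        two :* (t :- t :* w₁) :* (u :- u-rhs t w₁ u) :+
        (two :* t :* (u :- one) :* (w₁ :- w₁-rhs y t w₁) :+ con (pos 0)))
        refl y t w₁ u)
      (2# * (t - t * w₁) ∙ u-eq ⊕ 2# * t * (u - 1#) ∙ w₁-eq ⊕ refl))

    v*vDen≈vNum : v * vDen ≈ vNum s
    v*vDen≈vNum = x∙y⁻¹≈ε⇒x≈y _ _ (trans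
      (solve 4 (λ y t w₁ v →
        v :* vDenᵖ y t :- vNumᵖ y t (sᵖ t w₁) :=
        two :* (t :* w₁) :* (v :- v-rhs t w₁ v) :+
        (:- (two :* t :* (v :+ one)) :* (w₁ :- w₁-rhs y t w₁) :+ con (pos 0)))
        refl y t w₁ v)
      (2# * (t * w₁) ∙ v-eq ⊕ - (2# * t * (v + 1#)) ∙ w₁-eq ⊕ refl))

    r*[1+uv]≈1+u : r * (1# + u * v) ≈ 1# + u
    r*[1+uv]≈1+u = x∙y⁻¹≈ε⇒x≈y _ _ (trans
      (solve 4 (λ t w₁ u v →
        (one :+ t :- t :* w₁) :* (one :+ u :* v) :- (one :+ u) :=
        u :* (v :- v-rhs t w₁ v) :+
        (:- one :* (u :- u-rhs t w₁ u) :+ con (pos 0)))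
        refl t w₁ u v)
      (u ∙ v-eq ⊕ - 1# ∙ u-eq ⊕ refl))

-- Power series: cancellation and fixed points

module SeriesProperties (R : CommutativeRing c ℓ) where
  open CommutativeRing R
  open PowerSeries R hiding (commutativeRing)
  private module Coeff = Regularity R
  open Regularity (PowerSeries.commutativeRing R) using (Regular)

  X*-zero : ∀ f → (X *ˢ f) 0 ≈ 0#
  X*-zero f = trans (+-identityʳ _) (zeroˡ _)

  X*-suc : ∀ f n → (X *ˢ f) (suc n) ≈ f n
  X*-suc f n = trans
    (+-cong (zeroˡ _)
            (trans (*ˢ-cong {shift X} {1ˢ} {f} shift-X (λ _ → refl) n) (*ˢ-identityˡ f n)))
    (+-identityˡ _)
    where
    shift-X : ∀ k → shift X k ≈ 1ˢ k
    shift-X zero    = refl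
    shift-X (suc _) = refl

  X-regular : Regular X
  X-regular {f} eq = coeffwise λ n → trans (sym (X*-suc f n)) (coeff-≈ eq (suc n))

  -- If f g = 0, the constant coefficient forces g₀ = 0; then f annihilates `shift g` as well, and
  -- the argument repeats.
  leading-regular : ∀ f → Coeff.Regular (f 0) → Regular f
  leading-regular f f₀-regular eq = coeffwise λ n → coefficient n _ (coeff-≈ eq)
    where
    coefficient : ∀ n g → (∀ k → (f *ˢ g) k ≈ 0#) → g n ≈ 0#
    coefficient zero    g fg≈0 = f₀-regular (trans (sym (+-identityʳ _)) (fg≈0 0))
    coefficient (suc n) g fg≈0 = coefficient n (shift g) λ k → begin
      (f *ˢ shift g) k                      ≈⟨ +-identityˡ _ ⟨
      0# + (f *ˢ shift g) k                 ≈⟨ +-congʳ (zeroʳ _) ⟨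
      f (suc k) * 0# + (f *ˢ shift g) k     ≈⟨ +-congʳ (*-congˡ (coefficient 0 g fg≈0)) ⟨
      f (suc k) * g 0 + (f *ˢ shift g) k    ≈⟨ *ˢ-suc f g k ⟨
      (f *ˢ g) (suc k)                      ≈⟨ fg≈0 (suc k) ⟩
      0#                                    ∎
      where open SetoidReasoning setoid

  [1+X-a[Xf]]₀≈1 : ∀ a f → (1ˢ +ˢ X +ˢ -ˢ (a *ˢ (X *ˢ f))) 0 ≈ 1#
  [1+X-a[Xf]]₀≈1 a f = begin
    1# + 0# + - (a 0 * (X *ˢ f) 0 + 0#)
      ≈⟨ +-cong (+-identityʳ 1#) (-‿cong (trans (+-identityʳ _) (*-congˡ (X*-zero f)))) ⟩
    1# - a 0 * 0#  ≈⟨ +-congˡ (trans (-‿cong (zeroʳ (a 0))) -0#≈0#) ⟩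
    1# + 0#        ≈⟨ +-identityʳ 1# ⟩
    1#             ∎
    where
    open SetoidReasoning setoid
    open RingProperties ring using (-0#≈0#)

  [1+fg]₀≈1 : ∀ f g → f 0 ≈ 0# → (1ˢ +ˢ f *ˢ g) 0 ≈ 1#
  [1+fg]₀≈1 f g f₀≈0 =
    trans (+-congˡ (trans (+-identityʳ _) (trans (*-congʳ f₀≈0) (zeroˡ (g 0))))) (+-identityʳ 1#)

  infix 4 _≈[_]_
  _≈[_]_ : Series → ℕ → Series → Set ℓ
  f ≈[ n ] g = ∀ k → k ℕ.< n → f k ≈ g k

  *ˢ-cong-≤ : ∀ n {f f′ g g′} → f ≈[ suc n ] f′ → g ≈[ suc n ] g′ → (f *ˢ g) n ≈ (f′ *ˢ g′) n
  *ˢ-cong-≤ zero    p q = +-congʳ (*-cong (p 0 (s≤s z≤n)) (q 0 (s≤s z≤n)))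
  *ˢ-cong-≤ (suc n) p q = +-cong (*-cong (p 0 (s≤s z≤n)) (q (suc n) ℕ.≤-refl))
    (*ˢ-cong-≤ n (λ k k≤n → p (suc k) (s≤s k≤n)) (λ k k≤n → q k (ℕ.m≤n⇒m≤1+n k≤n)))

  *ˢ-cong-< : ∀ {n f f′ g g′} → f ≈[ n ] f′ → g ≈[ n ] g′ → f *ˢ g ≈[ n ] f′ *ˢ g′
  *ˢ-cong-< p q k k<n = *ˢ-cong-≤ k (λ i i≤k → p i (ℕ.≤-trans i≤k k<n))
                                    (λ i i≤k → q i (ℕ.≤-trans i≤k k<n))

  -- The right-hand side determines one more coefficient than it uses, so its iterates
  -- starting from 0 stabilise.
  quadratic-fixpoint : ∀ a b d → ∃ λ f → f ≈ˢ a +ˢ X *ˢ (b *ˢ f +ˢ d *ˢ (f *ˢ f))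
  quadratic-fixpoint a b d = solution , coeffwise solution-fixpoint
    where
    Ψ Φ : Series → Series
    Ψ f = b *ˢ f +ˢ d *ˢ (f *ˢ f)
    Φ f = a +ˢ X *ˢ Ψ f

    Ψ-cong : ∀ {n} f g → f ≈[ n ] g → Ψ f ≈[ n ] Ψ g
    Ψ-cong f g p k k<n = +-cong
      (*ˢ-cong-< {f = b} (λ _ _ → refl) p k k<n)
      (*ˢ-cong-< {f = d} {g = f *ˢ f} (λ _ _ → refl) (*ˢ-cong-< {f = f} {g = f} p p) k k<n)

    Φ-contracts : ∀ {n} f g → f ≈[ n ] g → Φ f ≈[ suc n ] Φ g
    Φ-contracts f g p zero    _         = +-congˡ (trans (X*-zero (Ψ f)) (sym (X*-zero (Ψ g))))
    Φ-contracts f g p (suc k) (s≤s k<n) = +-congˡ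
      (trans (X*-suc (Ψ f) k) (trans (Ψ-cong f g p k k<n) (sym (X*-suc (Ψ g) k))))

    iterate : ℕ → Series
    iterate zero    = 0ˢ
    iterate (suc m) = Φ (iterate m)

    iterate-step : ∀ m → iterate m ≈[ m ] iterate (suc m)
    iterate-step zero    k ()
    iterate-step (suc m) = Φ-contracts (iterate m) (iterate (suc m)) (iterate-step m)

    solution : Series
    -- `iterate m` is final in the coefficients below `m`, so coefficient `n` is final from iterate
    -- n + 1 on.
    solution n = iterate (suc n) n

    iterate-stable : ∀ k j → solution k ≈ iterate (j ℕ.+ suc k) k
    iterate-stable k zero    = refl
    iterate-stable k (suc j) =
      trans (iterate-stable k j) (iterate-step (j ℕ.+ suc k) k (ℕ.m≤n+m (suc k) j))

    solution-iterate : ∀ m → solution ≈[ m ] iterate m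
    solution-iterate m k k<m =
      trans (iterate-stable k (m ℕ.∸ suc k))
            (reflexive (≡.cong (λ i → iterate i k) (ℕ.m∸n+n≡m k<m)))

    solution-fixpoint : ∀ n → solution n ≈ Φ solution n
    -- Coefficient `n` of `Φ solution` depends only on coefficients of `solution` below `n`, and
    -- these agree with `iterate n`.
    solution-fixpoint n = sym (Φ-contracts solution (iterate n) (solution-iterate n) n ℕ.≤-refl)

module SeriesSubstitution (R : CommutativeRing c ℓ) (y : ℕ → CommutativeRing.Carrier R) where
  private module R = CommutativeRing R
  open PowerSeries R using (coeff-≈) renaming (X to t)
  open CommutativeRing (PowerSeries.commutativeRing R)
  open SeriesProperties R
  open SubstitutionIdentities (PowerSeries.commutativeRing R) y t using (module Construction)

  abstract
    -- The equation w (1 + t - w) = y t with w = t w₁, divided by t and solved for the linear term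
    -- w₁.
    w₁-solution : ∃ λ w₁ → w₁ ≈ y + t * (- 1# * w₁ + 1# * (w₁ * w₁))
    w₁-solution = quadratic-fixpoint y (- 1#) 1#

    -- With w = t w₁ this is (1 - w) u = t - w. The zero coefficient of the square makes a linear
    -- equation an instance of `quadratic-fixpoint`, which replaces the inversion of 1 - w.
    u-solution : ∀ w₁ → ∃ λ u → u ≈ t * (1# - w₁) + t * (w₁ * u + 0# * (u * u))
    u-solution w₁ = quadratic-fixpoint (t * (1# - w₁)) w₁ 0#

    -- With w = t w₁ this is (1 + t - w) v = w, that is, r v = w.
    v-solution : ∀ w₁ → ∃ λ v → v ≈ t * w₁ + t * ((w₁ - 1#) * v + 0# * (v * v))
    v-solution w₁ = quadratic-fixpoint (t * w₁) (w₁ - 1#) 0#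

  w₁ u v : Carrier
  w₁ = proj₁ w₁-solution
  u  = proj₁ (u-solution w₁)
  v  = proj₁ (v-solution w₁)

  open Construction w₁ u v (proj₂ w₁-solution) (proj₂ (u-solution w₁)) (proj₂ (v-solution w₁)) public

  s₀≈1 : s 0 R.≈ R.1#
  s₀≈1 = [1+X-a[Xf]]₀≈1 (1# + 1#) w₁

  [1+uv]₀≈1 : (1# + u * v) 0 R.≈ R.1#
  [1+uv]₀≈1 = [1+fg]₀≈1 u v (R.trans (coeff-≈ (proj₂ (u-solution w₁)) 0)
    (R.trans (R.+-cong (X*-zero (1# - w₁)) (X*-zero (w₁ * u + 0# * (u * u))))
             (R.+-identityʳ R.0#)))

2≉0 : CommutativeRing c ℓ → Set ℓ
2≉0 R = ¬ (1# + 1# ≈ 0#)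
  where open CommutativeRing R

module SecondIdentity (R : CommutativeRing c ℓ) (D : IsIntegralDomain R) (1+1≉0 : 2≉0 R) where
  private
    module R = CommutativeRing R
    module P = Polynomial R
    module K = CommutativeRing P.commutativeRing
    module S = PowerSeries P.commutativeRing
    module PD = IsIntegralDomain (P.isIntegralDomain D)
    module D = IsIntegralDomain D
    module KR = Regularity P.commutativeRing
  open SeriesProperties P.commutativeRing
  open Regularity S.commutativeRing
  open PowerSeriesInT R
  open SubstitutionIdentities S.commutativeRing y t
    using (uDen; vDen; module Denominators; module Parameters)

  private
    coefficient : ∀ i p → p K.≈ K.0# → P.coeff p i R.≈ R.0#
    coefficient i p p≈0 = PowerSeries.coeff-≈ (P.series-≈ p≈0) i

    leading≉0 : ∀ f → ¬ (f 0 K.≈ K.0#) → Regular f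
    leading≉0 f f₀≉0 = leading-regular f (KR.domain-regular (P.isIntegralDomain D) f₀≉0)

    leading1 : ∀ f → f 0 K.≈ K.1# → Regular f
    leading1 f f₀≈1 = leading≉0 f λ f₀≈0 → PD.1≉0 (K.trans (K.sym f₀≈1) f₀≈0)

    2-regular : Regular 2#
    2-regular = leading≉0 2# λ eq → 1+1≉0 (coefficient 0 (2# 0) eq)

    y-regular : Regular y
    y-regular = leading≉0 y λ eq → D.1≉0 (coefficient 1 (y 0) eq)

    1-y-regular : Regular (1# - y)
    1-y-regular = leading≉0 (1# - y) λ eq → D.1≉0
      (R.trans (R.sym (R.trans (R.+-congˡ -0#≈0#) (R.+-identityʳ R.1#)))
               (coefficient 0 ((1# - y) 0) eq))
      where open RingProperties R.ring using (-0#≈0#)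

    open Denominators 2-regular y-regular 1-y-regular X-regular

    B-1≉0 : ¬ (1# ≈ 0#)
    B-1≉0 eq = PD.1≉0 (S.coeff-≈ eq 0)

  second-identity : ∀ n → n ≥ 1 → (σ : Substitution) → let open Substitution σ in
                    Ppk,des n y t ≈ (r ^ suc n) * A n v
  second-identity n n≥1 σ =
    Invariance.Ppk,des≈r^*A S.commutativeRing n n≥1 y t r v E.r+rv≈1+t E.rrv≈yt
    where
    open Substitution σ
    module E = Parameters 2-regular uDen-regular vDen-regular s u v r
      (leading1 s (proj₁ s-sqrt)) (proj₂ s-sqrt) (proj₂ u-def) (proj₂ v-def) (proj₂ r-def)

  -- The series required by the formulas exist, so the second identity, quantified over all such
  -- data, is not vacuous.
  substitution : Substitution
  substitution = record
    { s      = E.s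
    ; u      = E.u
    ; v      = E.v
    ; r      = E.r
    ; s-sqrt = E.s₀≈1 , E.s^2≈discriminant
    ; u-def  = regular⇒≉0 B-1≉0 {uDen} uDen-regular , E.u*uDen≈uNum
    ; v-def  = regular⇒≉0 B-1≉0 {vDen} vDen-regular , E.v*vDen≈vNum
    ; r-def  = regular⇒≉0 B-1≉0 {1# + E.u * E.v} (leading1 (1# + E.u * E.v) E.[1+uv]₀≈1)
             , E.r*[1+uv]≈1+u
    }
    where module E = SeriesSubstitution P.commutativeRing y

theorem4p2 : (n : ℕ) → n ≥ 1 →
    (let open ℚ⟨y,t⟩ in
      A n t ≈ (((1# + y * t) / (1# + y) [ 1+y≉0 ]) ^ suc n)
              * Ppk,des n (((1# + y) ^ 2 * t) / ((y + t) * (1# + y * t)) [ [y+t][1+yt]≉0 ])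
                          ((y + t) / (1# + y * t) [ 1+yt≉0 ]))
    ×
    (let open PowerSeriesInT ℚ-ring in
      Substitution
      × ((σ : Substitution) → let open Substitution σ in
           Ppk,des n y t ≈ (r ^ suc n) * A n v))
theorem4p2 n n≥1 = FirstIdentity.first-identity n n≥1 , S.substitution , S.second-identity n n≥1
  where module S = SecondIdentity ℚ-ring ℚ-isIntegralDomain (λ ())
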